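{- Let $n\equiv 2\pmod 6$ with $n\geq 8$, let $C_n$ be the cycle on $n$ vertices, and let $u_1,u_2$ be distinct vertices of $C_n$ at distance $d=d(u_1,u_2)$ in $C_n$. Then $$\gamma_g^t(C_n|\{u_1,u_2\}) = \begin{cases} \gamma_g^t(C_n), & d\equiv 4 \pmod 6,\\ \gamma_g^t(C_n)-1, & d \bmod 6\in\{1,3,5\},\\ \gamma_g^t(C_n)-2, & d\bmod 6\in\{0,2\}.\end{cases}$$
   Context: The total domination game on a graph $G$ in which a set $S\subseteq V(G)$ is predominated: Dominator and Staller alternately choose vertices of $G$. A vertex $w$ is totally dominated if it lies in $S$ or if some neighbor of $w$ has already been chosen. A vertex may be chosen only if it has at least one neighbor that is not yet totally dominated. The game ends when no legal move remains. Dominator aims to minimize and Staller to maximize the number of moves. $\gamma_g^t(G|S)$ is the number of moves when Dominator starts and both play optimally; $\gamma_g^t(G)=\gamma_g^t(G|\emptyset)$. -}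

module Defs where

open import Data.Nat using (ℕ; zero; suc; _+_; _⊔_; _⊓_; _≡ᵇ_; ∣_-_∣; _∸_)
open import Data.Bool using (Bool; true; false; _∨_; _∧_; not; if_then_else_)
open import Data.Fin using (Fin; toℕ)
open import Data.List using (List; []; _∷_; filter; map; foldr; allFin)
open import Data.Bool.ListAction using (any)
open import Data.Bool.Properties using (T?)

record Graph : Set where
  field
    order : ℕ
    adj   : Fin order → Fin order → Bool

open Graph public

-- A vertex set (the set of currently totally dominated vertices, or a
-- predominated set S), as a characteristic function.
VSet : ℕ → Set
VSet n = Fin n → Bool

legal : (G : Graph) → VSet (order G) → Fin (order G) → Bool
legal G D v = any (λ w → adj G v w ∧ not (D w)) (allFin (order G))

play : (G : Graph) → VSet (order G) → Fin (order G) → VSet (order G)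
play G D v w = D w ∨ adj G v w

legalMoves : (G : Graph) → VSet (order G) → List (Fin (order G))
legalMoves G D = filter (λ v → T? (legal G D v)) (allFin (order G))

data Player : Set where
  Dominator Staller : Player

-- optimal number of remaining moves with the given player to move.
-- Dominator minimises, Staller maximises.  Every legal move totally
-- dominates at least one new vertex, so the game lasts at most (order G)
-- moves; the fuel argument (initially order G) is therefore never exhausted
-- before the game ends.
value : (G : Graph) → ℕ → Player → VSet (order G) → ℕ
value G zero p D = 0
value G (suc k) p D with legalMoves G D
... | [] = 0
... | v ∷ vs with p
...   | Dominator = suc (foldr (λ u r → value G k Staller (play G D u) ⊓ r)
                                (value G k Staller (play G D v)) vs)
...   | Staller   = suc (foldr (λ u r → value G k Dominator (play G D u) ⊔ r)
                                (value G k Dominator (play G D v)) vs)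

γgt∣ : (G : Graph) → VSet (order G) → ℕ
γgt∣ G S = value G (order G) Dominator S

γgt : Graph → ℕ
γgt G = γgt∣ G (λ _ → false)

cycSucc : (n : ℕ) → Fin n → ℕ
cycSucc n i = if (toℕ i + 1) ≡ᵇ n then 0 else toℕ i + 1

Cycle : ℕ → Graph
Cycle n = record
  { order = n
  ; adj   = λ i j → (cycSucc n i ≡ᵇ toℕ j) ∨ (cycSucc n j ≡ᵇ toℕ i)
  }

cycDist : (n : ℕ) → Fin n → Fin n → ℕ
cycDist n i j = ∣ toℕ i - toℕ j ∣ ⊓ (n ∸ ∣ toℕ i - toℕ j ∣)

pair : {n : ℕ} → Fin n → Fin n → VSet n
pair u₁ u₂ w = ((toℕ w ≡ᵇ toℕ u₁) ∨ (toℕ w ≡ᵇ toℕ u₂))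

{-# OPTIONS --safe #-}
module Submission where

-- For n = 2m the vertices to be dominated split by parity into two cyclic words of
-- length m, and playing a vertex covers two cyclically adjacent letters of one word.
-- Once a word has a covered letter, only the lengths of its uncovered runs matter.
-- Give a run of length 3q, 3q + 1, 3q + 2 the weight 4q, 4q + 2, 4q + 3, and let W be
-- the total weight.  Every move inside runs lowers W by 1, 2 or 3.  If W is odd, some
-- run has length ≡ 2 (mod 3) and allows both a drop by 3 and a drop by 1; if W > 0 is
-- even, there are a move dropping W by at least 2 and one dropping it by at most 2.
-- Hence the game without untouched words has value ⌊W/2⌋ or ⌈W/2⌉ when Dominator or
-- Staller is to move.  With m = 3k + 1, the first move in an untouched word adds
-- 4k − 1 to W, so with one untouched word the values are 2k + 1 + 2⌊W/4⌋ and
-- 2k + 2⌈W/4⌉, and with two they are 4k + 1 and 4k.  A pair in different words leaves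
-- W = 8k; a pair in the same word leaves W = 4k or 4k − 1 and an untouched word.

open import Defs
open import Data.Bool using (Bool; true; false; T; _∨_; _∧_; not)
open import Data.Bool.Properties using (T?; T-∨; T-∧; T-≡; T-not-≡; ∨-identityʳ; ∨-zeroʳ)
open import Data.Fin using (Fin; toℕ)
open import Data.Fin.Properties using (toℕ-injective; toℕ-fromℕ<; toℕ<n)
open import Data.List using (List; []; _∷_; foldr; allFin)
open import Data.List.Membership.Propositional using (_∈_; lose)
open import Data.List.Membership.Propositional.Properties using (∈-filter⁺; ∈-filter⁻; ∈-allFin)
open import Data.List.Relation.Unary.Any using (here; there; satisfied)
open import Data.List.Relation.Unary.Any.Properties using (any⁺; any⁻)
open import Data.Nat
open import Data.Nat.DivMod
open import Data.Nat.ListAction using (sum)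
open import Data.Nat.Properties
open import Data.Nat.Tactic.RingSolver using (solve-∀)
open import Data.Product using (_×_; _,_; proj₁; proj₂; ∃-syntax)
open import Data.Sum using (_⊎_; inj₁; inj₂; [_,_]′)
open import Function.Bundles using (Equivalence)
open import Relation.Binary.Definitions using (Tri; tri<; tri≈; tri>)
open import Relation.Binary.PropositionalEquality
open import Relation.Nullary using (¬_; contradiction; yes; no)

-- Weights and moves on lists of runs

-- The lists record the gaps between consecutive covered letters.  A move on the letters
-- i and i + 1 leaves both covered, hence the gaps of length 0.
data Move : ℕ → List ℕ → List ℕ → Set where
  left  : ∀ {b ℓs} → Move 0 (suc b ∷ ℓs) (0 ∷ b ∷ ℓs)
  right : ∀ {a ℓs} → Move (suc a) (suc a ∷ ℓs) (a ∷ 0 ∷ ℓs)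
  mid   : ∀ {a b ℓs} → Move (suc a) (2 + (a + b) ∷ ℓs) (a ∷ 0 ∷ b ∷ ℓs)
  there : ∀ {i ℓ ℓs ℓs′} → Move i ℓs ℓs′ → Move (suc ℓ + i) (ℓ ∷ ℓs) (ℓ ∷ ℓs′)

runWeight : ℕ → ℕ
runWeight 0 = 0
runWeight 1 = 2
runWeight 2 = 3
runWeight (suc (suc (suc ℓ))) = 4 + runWeight ℓ

runsWeight : List ℕ → ℕ
runsWeight []       = 0
runsWeight (ℓ ∷ ℓs) = runWeight ℓ + runsWeight ℓs

runWeight-residue : ∀ r q → runWeight (r + q * 3) ≡ runWeight r + q * 4
runWeight-residue r q = begin
  runWeight (r + q * 3)  ≡⟨ cong runWeight (+-comm r (q * 3)) ⟩
  runWeight (q * 3 + r)  ≡⟨ go q ⟩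
  q * 4 + runWeight r    ≡⟨ +-comm (q * 4) _ ⟩
  runWeight r + q * 4    ∎
  where
  open ≡-Reasoning
  go : ∀ q → runWeight (q * 3 + r) ≡ q * 4 + runWeight r
  go zero    = refl
  go (suc q) = cong (4 +_) (go q)

runWeight-suc-< : ∀ ℓ → runWeight ℓ < runWeight (suc ℓ)
runWeight-suc-< 0 = s≤s z≤n
runWeight-suc-< 1 = ≤-refl
runWeight-suc-< 2 = ≤-refl
runWeight-suc-< (suc (suc (suc ℓ))) = +-monoʳ-< 4 (runWeight-suc-< ℓ)

runWeight-suc-≤ : ∀ ℓ → runWeight (suc ℓ) ≤ 2 + runWeight ℓ
runWeight-suc-≤ 0 = ≤-refl
runWeight-suc-≤ 1 = n≤1+n 3
runWeight-suc-≤ 2 = n≤1+n 4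
runWeight-suc-≤ (suc (suc (suc ℓ))) = +-monoʳ-≤ 4 (runWeight-suc-≤ ℓ)

runWeight-2+-≤ : ∀ ℓ → 2 + runWeight ℓ ≤ runWeight (2 + ℓ)
runWeight-2+-≤ ℓ = ≤-trans (s≤s (runWeight-suc-< ℓ)) (runWeight-suc-< (suc ℓ))

runWeight-2+-≤′ : ∀ ℓ → runWeight (2 + ℓ) ≤ 3 + runWeight ℓ
runWeight-2+-≤′ 0 = ≤-refl
runWeight-2+-≤′ 1 = n≤1+n 4
runWeight-2+-≤′ 2 = ≤-refl
runWeight-2+-≤′ (suc (suc (suc ℓ))) = +-monoʳ-≤ 4 (runWeight-2+-≤′ ℓ)

-- Lowering `a` by 3 lowers both sides by 4, so only `a` = 0, 1, 2 need an argument, and there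
-- single-run bounds in `b` suffice. The upper bound `runWeight-split-≤` follows the same pattern.
runWeight-split-< : ∀ a b → runWeight a + runWeight b < runWeight (2 + (a + b))
runWeight-split-< 0 b = ≤-trans (n≤1+n _) (runWeight-2+-≤ b)
runWeight-split-< 1 b = n≤1+n _
runWeight-split-< 2 b = +-monoʳ-≤ 4 (<⇒≤ (runWeight-suc-< b))
runWeight-split-< (suc (suc (suc a))) b = +-monoʳ-≤ 4 (runWeight-split-< a b)

runWeight-split-≤ : ∀ a b → runWeight (2 + (a + b)) ≤ 3 + (runWeight a + runWeight b)
runWeight-split-≤ 0 b = runWeight-2+-≤′ b
runWeight-split-≤ 1 b = n≤1+n _
runWeight-split-≤ 2 b = +-monoʳ-≤ 4 (runWeight-suc-≤ b)
runWeight-split-≤ (suc (suc (suc a))) b = +-monoʳ-≤ 4 (runWeight-split-≤ a b)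

move-decreases : ∀ {i ℓs ℓs′} → Move i ℓs ℓs′ → runsWeight ℓs′ < runsWeight ℓs
move-decreases (left {b} {ℓs}) = +-monoˡ-≤ (runsWeight ℓs) (runWeight-suc-< b)
move-decreases (right {a} {ℓs}) = +-monoˡ-≤ (runsWeight ℓs) (runWeight-suc-< a)
move-decreases (mid {a} {b} {ℓs}) =
  subst (_< runWeight (2 + (a + b)) + runsWeight ℓs) (+-assoc (runWeight a) _ _)
    (+-monoˡ-≤ (runsWeight ℓs) (runWeight-split-< a b))
move-decreases (there {ℓ = ℓ} mv) = +-monoʳ-< (runWeight ℓ) (move-decreases mv)

+-left-comm : ∀ a x y → x + (a + y) ≡ a + (x + y)
+-left-comm = solve-∀

move-decreases-≤3 : ∀ {i ℓs ℓs′} → Move i ℓs ℓs′ → runsWeight ℓs ≤ 3 + runsWeight ℓs′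
move-decreases-≤3 (left {b} {ℓs}) =
  +-monoˡ-≤ (runsWeight ℓs) (≤-trans (runWeight-suc-≤ b) (n≤1+n _))
move-decreases-≤3 (right {a} {ℓs}) =
  +-monoˡ-≤ (runsWeight ℓs) (≤-trans (runWeight-suc-≤ a) (n≤1+n _))
move-decreases-≤3 (mid {a} {b} {ℓs}) =
  subst (runWeight (2 + (a + b)) + runsWeight ℓs ≤_) (cong (3 +_) (+-assoc (runWeight a) _ _))
    (+-monoˡ-≤ (runsWeight ℓs) (runWeight-split-≤ a b))
move-decreases-≤3 (there {ℓ = ℓ} {ℓs} {ℓs′} mv) =
  subst (runWeight ℓ + runsWeight ℓs ≤_) (+-left-comm 3 (runWeight ℓ) (runsWeight ℓs′))
    (+-monoʳ-≤ (runWeight ℓ) (move-decreases-≤3 mv))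

-- Parity of the weight, and moves with a prescribed drop

Even : ℕ → Set
Even n = ∃[ j ] n ≡ j + j

even-+ : ∀ {x y} → Even x → Even y → Even (x + y)
even-+ (i , refl) (j , refl) = i + j , lem i j
  where
  lem : ∀ x y → (x + x) + (y + y) ≡ (x + y) + (x + y)
  lem = solve-∀

-- With `_≡_`, `_≥_` or `_≤_` as the relation, the move lowers the weight by exactly, at least or at
-- most `c`.
MoveBy : ℕ → (ℕ → ℕ → Set) → List ℕ → Set
MoveBy c _∼_ ℓs = ∃[ i ] ∃[ ℓs′ ] Move i ℓs ℓs′ × (runsWeight ℓs ∼ (c + runsWeight ℓs′))

moveBy-there : ∀ {c ℓ ℓs} (_∼_ : ℕ → ℕ → Set) →
  (∀ k {x y} → x ∼ y → (k + x) ∼ (k + y)) →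
  MoveBy c _∼_ ℓs → MoveBy c _∼_ (ℓ ∷ ℓs)
moveBy-there {c} {ℓ} {ℓs} _∼_ mono (i , ℓs′ , mv , p) =
  suc ℓ + i , ℓ ∷ ℓs′ , there mv ,
  subst ((runWeight ℓ + runsWeight ℓs) ∼_) (+-left-comm c (runWeight ℓ) (runsWeight ℓs′)) (mono (runWeight ℓ) p)

-- The runs of odd weight are those of length ≡ 2 (mod 3).
even⊎exact-moves : ∀ ℓs → Even (runsWeight ℓs) ⊎ (MoveBy 3 _≡_ ℓs × MoveBy 1 _≡_ ℓs)
even⊎exact-moves [] = inj₁ (0 , refl)
even⊎exact-moves (ℓ ∷ ℓs) with even⊎exact-moves ℓs | residue ℓ
  where
  residue : ∀ ℓ → Even (runWeight ℓ) ⊎ ∃[ q ] ℓ ≡ 2 + q * 3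
  residue 0 = inj₁ (0 , refl)
  residue 1 = inj₁ (1 , refl)
  residue 2 = inj₂ (0 , refl)
  residue (suc (suc (suc ℓ))) with residue ℓ
  ... | inj₁ (j , e)    = inj₁ (2 + j , trans (cong (4 +_) e) (cong (2 +_) (sym (+-left-comm 2 j j))))
  ... | inj₂ (q , refl) = inj₂ (suc q , refl)
... | inj₂ (m₃ , m₁) | _ =
  inj₂ (moveBy-there {ℓ = ℓ} _≡_ (λ k → cong (k +_)) m₃ ,
        moveBy-there {ℓ = ℓ} _≡_ (λ k → cong (k +_)) m₁)
... | inj₁ even | inj₁ even′ = inj₁ (even-+ even′ even)
... | inj₁ _ | inj₂ (q , refl) =
  -- The run has weight 4q + 3. Covering its first two letters leaves length 3q and weight 4q;
  -- covering only its first letter leaves length 3q + 1 and weight 4q + 2.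
  inj₂ ((1 , 0 ∷ 0 ∷ q * 3 ∷ ℓs , mid , by₃) , (0 , 0 ∷ 1 + q * 3 ∷ ℓs , left , by₁))
  where
  by₃ : runWeight (2 + q * 3) + runsWeight ℓs ≡ 3 + (runWeight (q * 3) + runsWeight ℓs)
  by₃ rewrite runWeight-residue 2 q | runWeight-residue 0 q = refl
  by₁ : runWeight (2 + q * 3) + runsWeight ℓs ≡ 1 + (runWeight (1 + q * 3) + runsWeight ℓs)
  by₁ rewrite runWeight-residue 2 q | runWeight-residue 1 q = refl

-- In the first nonempty run, a lone letter already carries weight 2; from a longer run two letters
-- are taken.
fast-move : ∀ ℓs → 0 < runsWeight ℓs → MoveBy 2 _≥_ ℓs
fast-move (0 ∷ ℓs) 0<w = moveBy-there {ℓ = 0} _≥_ (λ k → +-monoʳ-≤ k) (fast-move ℓs 0<w)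
fast-move (1 ∷ ℓs) _ = 0 , _ , left , ≤-refl
fast-move (suc (suc ℓ) ∷ ℓs) _ =
  1 , 0 ∷ 0 ∷ ℓ ∷ ℓs , mid , +-monoˡ-≤ (runsWeight ℓs) (runWeight-2+-≤ ℓ)

-- A single end letter of the first nonempty run is taken: one letter never changes the weight of a
-- run by more than 2.
slow-move : ∀ ℓs → 0 < runsWeight ℓs → MoveBy 2 _≤_ ℓs
slow-move (0 ∷ ℓs) 0<w = moveBy-there {ℓ = 0} _≤_ (λ k → +-monoʳ-≤ k) (slow-move ℓs 0<w)
slow-move (suc ℓ ∷ ℓs) _ =
  0 , 0 ∷ ℓ ∷ ℓs , left , +-monoˡ-≤ (runsWeight ℓs) (runWeight-suc-≤ ℓ)

-- The value of a position

data ClassState : Set where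
  full : ClassState
  runs : List ℕ → ClassState

fulls : ClassState → ℕ
fulls full     = 1
fulls (runs _) = 0

-- An untouched class gets weight 0 by convention; such classes are counted separately by `fulls`.
weight : ClassState → ℕ
weight full      = 0
weight (runs ℓs) = runsWeight ℓs

-- m is two less than the length of the cyclic class.
data ClassMove (m : ℕ) : ClassState → ClassState → Set where
  -- The two covered letters are cyclically adjacent: one gap between them is empty, the other holds
  -- the remaining `m` letters.
  open-full : ClassMove m full (runs (0 ∷ m ∷ []))
  move-runs : ∀ {i ℓs ℓs′} → Move i ℓs ℓs′ → ClassMove m (runs ℓs) (runs ℓs′)

Position : Set
Position = ClassState × ClassState

data PositionMove (m : ℕ) : Position → Position → Set where
  move₀ : ∀ {c c′ e} → ClassMove m c c′ → PositionMove m (c , e) (c′ , e)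
  move₁ : ∀ {c e e′} → ClassMove m e e′ → PositionMove m (c , e) (c , e′)

positionFulls positionWeight : Position → ℕ
positionFulls  (c , e) = fulls c + fulls e
positionWeight (c , e) = weight c + weight e

quarter : ℕ → ℕ
quarter n = ⌊ ⌊ n /2⌋ /2⌋

quarter-mono : ∀ {x y} → x ≤ y → quarter x ≤ quarter y
quarter-mono p = ⌊n/2⌋-mono (⌊n/2⌋-mono p)

⌊/2⌋+⌊/2⌋≤ : ∀ n → ⌊ n /2⌋ + ⌊ n /2⌋ ≤ n
⌊/2⌋+⌊/2⌋≤ n = ≤-trans (+-monoʳ-≤ ⌊ n /2⌋ (⌊n/2⌋≤⌈n/2⌉ n)) (≤-reflexive (⌊n/2⌋+⌈n/2⌉≡n n))

≤⌈/2⌉+⌈/2⌉ : ∀ n → n ≤ ⌈ n /2⌉ + ⌈ n /2⌉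
≤⌈/2⌉+⌈/2⌉ n = ≤-trans (≤-reflexive (sym (⌊n/2⌋+⌈n/2⌉≡n n))) (+-monoˡ-≤ ⌈ n /2⌉ (⌊n/2⌋≤⌈n/2⌉ n))

even-suc-half : ∀ {n} → Even n → ⌊ suc n /2⌋ ≡ ⌊ n /2⌋
even-suc-half {n} (j , refl) = trans (sym (n≡⌈n+n/2⌉ j)) (n≡⌊n+n/2⌋ j)

⌊k*4+n/2⌋ : ∀ k n → ⌊ k * 4 + n /2⌋ ≡ k * 2 + ⌊ n /2⌋
⌊k*4+n/2⌋ zero n = refl
⌊k*4+n/2⌋ (suc k) n = cong (2 +_) (⌊k*4+n/2⌋ k n)

-- The effect of a move on the number `f` of untouched classes and on the weight `w`. A move inside
-- runs needs a touched class, hence `f ≤ 1`; if an opening leaves the other class untouched, there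
-- were no runs before, hence `w ≡ 0`. The increase 4k + 3 is 4(k + 1) - 1.
data Progress (k f w : ℕ) : ℕ → ℕ → Set where
  run   : ∀ {w′} → f ≤ 1 → w′ < w → w ≤ 3 + w′ → Progress k f w f w′
  opens : ∀ {f′ w′} → f ≡ suc f′ → f′ ≤ 1 → (f′ ≡ 1 → w ≡ 0) → w′ ≡ k * 4 + (3 + w) →
          Progress k f w f′ w′

⌊k*2+n/2⌋ : ∀ k n → ⌊ k * 2 + n /2⌋ ≡ k + ⌊ n /2⌋
⌊k*2+n/2⌋ zero n = refl
⌊k*2+n/2⌋ (suc k) n = cong suc (⌊k*2+n/2⌋ k n)

FastFrom SlowFrom : ℕ → ℕ → Set
FastFrom w w′ = w ≡ 3 + w′ ⊎ Even w × 2 + w′ ≤ w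
SlowFrom w w′ = w ≡ 1 + w′ ⊎ Even w × w ≤ 2 + w′

-- For even `w`, passing to `suc w` does not change the half, which makes up for a drop of only 2.
-- The same rounding gives `slow-half`.
fast-half : ∀ {w w′} → FastFrom w w′ → ⌊ 3 + w′ /2⌋ ≤ ⌊ w /2⌋
fast-half (inj₁ refl)    = ≤-refl
fast-half (inj₂ (e , p)) = ≤-trans (⌊n/2⌋-mono (s≤s p)) (≤-reflexive (even-suc-half e))

slow-half : ∀ {w w′} → SlowFrom w w′ → ⌊ suc w /2⌋ ≤ ⌊ 2 + w′ /2⌋
slow-half (inj₁ refl)    = ≤-refl
slow-half (inj₂ (e , p)) = ≤-trans (≤-reflexive (even-suc-half e)) (⌊n/2⌋-mono p)

-- Here k is one less than in the introduction: a class has length 3(k + 1) + 1.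
-- The numeric arguments of val are the number of untouched classes and the weight W.
module Value (k : ℕ) where

  val : Player → ℕ → ℕ → ℕ
  val Dominator 0 w = ⌊ w /2⌋
  val Staller   0 w = ⌊ suc w /2⌋
  val Dominator 1 w = 3 + (k * 2 + (quarter w + quarter w))
  -- `quarter (3 + w)` is w/4 rounded up.
  val Staller   1 w = 2 + (k * 2 + (quarter (3 + w) + quarter (3 + w)))
  -- Two untouched classes leave no runs, so W = 0 there and the values are constants.
  val Dominator (suc (suc _)) w = 5 + k * 4
  val Staller   (suc (suc _)) w = 4 + k * 4

  +-dbl-mono : ∀ {x y} → x ≤ y → k * 2 + (x + x) ≤ k * 2 + (y + y)
  +-dbl-mono p = +-monoʳ-≤ (k * 2) (+-mono-≤ p p)

  +-dbl-suc : ∀ q → k * 2 + (suc q + suc q) ≡ 2 + (k * 2 + (q + q))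
  +-dbl-suc q = lem (k * 2) q
    where
    lem : ∀ x q → x + (suc q + suc q) ≡ 2 + (x + (q + q))
    lem = solve-∀

  half-shift : ∀ c n → ⌊ c + (k * 4 + n) /2⌋ ≡ k * 2 + ⌊ c + n /2⌋
  half-shift c n = trans (cong ⌊_/2⌋ (+-left-comm (k * 4) c n)) (⌊k*4+n/2⌋ k (c + n))

  dbl-quarter-shift : ∀ c → k * 2 + (quarter (c + (k * 4 + 3)) + quarter (c + (k * 4 + 3))) ≡
    k * 4 + (quarter (c + 3) + quarter (c + 3))
  dbl-quarter-shift c rewrite half-shift c 3 | ⌊k*2+n/2⌋ k ⌊ c + 3 /2⌋ = lem k (quarter (c + 3))
    where
    lem : ∀ k q → k * 2 + (k + q + (k + q)) ≡ k * 4 + (q + q)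
    lem = solve-∀

  staller-opens₁ : ∀ w → val Staller 0 (k * 4 + (3 + w)) ≡ 2 + (k * 2 + ⌊ w /2⌋)
  staller-opens₁ w = trans (half-shift 1 (3 + w)) (+-left-comm 2 (k * 2) _)

  dominator-opens₁ : ∀ w → val Dominator 0 (k * 4 + (3 + w)) ≡ 1 + (k * 2 + ⌊ suc w /2⌋)
  dominator-opens₁ w = trans (half-shift 0 (3 + w)) (+-left-comm 1 (k * 2) _)

  staller-opens₂ : val Staller 1 (k * 4 + 3) ≡ 4 + k * 4
  staller-opens₂ = trans (cong (2 +_) (dbl-quarter-shift 3)) (cong (2 +_) (+-comm (k * 4) 2))

  dominator-opens₂ : val Dominator 1 (k * 4 + 3) ≡ 3 + k * 4
  dominator-opens₂ = cong (3 +_) (trans (dbl-quarter-shift 0) (+-identityʳ _))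

  -- No move takes Dominator below `val`. Inside runs this is monotonicity of halving applied to
  -- `w ≤ 3 + w′`. Opening the last untouched class costs nothing less because twice ⌊w/4⌋ is at
  -- most ⌊w/2⌋; opening the first of two gives equality.
  dominator-all : ∀ {f w f′ w′} → Progress k f w f′ w′ → val Dominator f w ≤ suc (val Staller f′ w′)
  dominator-all {0} (run _ _ p) = ⌊n/2⌋-mono p
  dominator-all {1} (run _ _ p) = +-monoʳ-≤ 3 (+-dbl-mono (quarter-mono p))
  dominator-all {suc (suc _)} (run (s≤s ()) _ _)
  dominator-all {w = w} (opens {0} refl _ _ refl) rewrite staller-opens₁ w =
    +-monoʳ-≤ 3 (+-monoʳ-≤ (k * 2) (⌊/2⌋+⌊/2⌋≤ ⌊ w /2⌋))
  dominator-all (opens {1} refl _ w≡0 refl) rewrite w≡0 refl = ≤-reflexive (cong suc (sym staller-opens₂))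
  dominator-all (opens {suc (suc _)} _ (s≤s ()) _ _)

  -- Dual to `dominator-all`: inside runs only `w′ < w` matters, and opening the last untouched
  -- class uses that rounding up a half at most shrinks the number before doubling back to at least
  -- the original.
  staller-all : ∀ {f w f′ w′} → Progress k f w f′ w′ → suc (val Dominator f′ w′) ≤ val Staller f w
  staller-all {0} (run _ p _) = ⌊n/2⌋-mono (s≤s p)
  staller-all {1} {w′ = w′} (run _ p _) =
    ≤-trans (≤-reflexive (cong (2 +_) (sym (+-dbl-suc (quarter w′)))))
      (+-monoʳ-≤ 2 (+-dbl-mono (quarter-mono (+-monoʳ-≤ 3 p))))
  staller-all {suc (suc _)} (run (s≤s ()) _ _)
  staller-all {w = w} (opens {0} refl _ _ refl) rewrite dominator-opens₁ w =
    +-monoʳ-≤ 2 (+-monoʳ-≤ (k * 2) (≤⌈/2⌉+⌈/2⌉ ⌊ suc w /2⌋))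
  staller-all (opens {1} refl _ w≡0 refl) rewrite w≡0 refl = ≤-reflexive (cong suc dominator-opens₂)
  staller-all (opens {suc (suc _)} _ (s≤s ()) _ _)

  -- With one untouched class, values are built from quarters, so `fast-half` is halved once more;
  -- `staller-run` does the same with `slow-half`.
  dominator-run : ∀ {f w w′} → f ≤ 1 → FastFrom w w′ → suc (val Staller f w′) ≤ val Dominator f w
  dominator-run {0} _ p = fast-half p
  dominator-run {1} _ p = +-monoʳ-≤ 3 (+-dbl-mono (⌊n/2⌋-mono (fast-half p)))
  dominator-run {suc (suc _)} (s≤s ()) _

  staller-run : ∀ {f w w′} → f ≤ 1 → SlowFrom w w′ → val Staller f w ≤ suc (val Dominator f w′)
  staller-run {0} _ p = slow-half p
  staller-run {1} {w′ = w′} _ p =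
    ≤-trans (+-monoʳ-≤ 2 (+-dbl-mono (⌊n/2⌋-mono (s≤s (slow-half p)))))
      (≤-reflexive (cong (2 +_) (+-dbl-suc (quarter w′))))
  staller-run {suc (suc _)} (s≤s ()) _

  -- Meant for W = 0, where the only moves are openings; 4k + 3 is the weight of the run that an
  -- opening creates.
  dominator-open : ∀ {f} → f ≤ 1 → suc (val Staller f (k * 4 + 3)) ≤ val Dominator (suc f) 0
  dominator-open {0} _ = ≤-reflexive (cong suc (staller-opens₁ 0))
  dominator-open {1} _ = ≤-reflexive (cong suc staller-opens₂)
  dominator-open {suc (suc _)} (s≤s ())

  staller-open : ∀ {f} → f ≤ 1 → val Staller (suc f) 0 ≤ suc (val Dominator f (k * 4 + 3))
  staller-open {0} _ = ≤-reflexive (cong suc (sym (dominator-opens₁ 0)))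
  staller-open {1} _ = ≤-reflexive (cong suc (sym dominator-opens₂))
  staller-open {suc (suc _)} (s≤s ())

-- Moves available in a position and their effect

fulls≤1 : ∀ c → fulls c ≤ 1
fulls≤1 full     = ≤-refl
fulls≤1 (runs _) = z≤n

-- The number of uncovered letters strictly drops with every move and so bounds the fuel that the
-- game requires.
uncovered : ℕ → ClassState → ℕ
uncovered m full      = 2 + m
uncovered m (runs ℓs) = sum ℓs

positionUncovered : ℕ → Position → ℕ
positionUncovered m (c , e) = uncovered m c + uncovered m e

move-sum-decreases : ∀ {i ℓs ℓs′} → Move i ℓs ℓs′ → sum ℓs′ < sum ℓs
move-sum-decreases left          = ≤-refl
move-sum-decreases right         = ≤-refl
move-sum-decreases (mid {a} {b} {ℓs}) =
  s≤s (≤-trans (≤-reflexive (sym (+-assoc a b (sum ℓs)))) (n≤1+n _))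
move-sum-decreases (there {ℓ = ℓ} mv) = +-monoʳ-< ℓ (move-sum-decreases mv)

classMove-uncovered : ∀ {m c c′} → ClassMove m c c′ → uncovered m c′ < uncovered m c
classMove-uncovered {m} open-full  = s≤s (≤-trans (≤-reflexive (+-identityʳ m)) (n≤1+n m))
classMove-uncovered (move-runs mv) = move-sum-decreases mv

positionMove-uncovered : ∀ {m s s′} → PositionMove m s s′ → positionUncovered m s′ < positionUncovered m s
positionMove-uncovered {m} (move₀ {e = e} mv) = +-monoˡ-< (uncovered m e) (classMove-uncovered mv)
positionMove-uncovered {m} (move₁ {c = c} mv) = +-monoʳ-< (uncovered m c) (classMove-uncovered mv)

RunMove : ℕ → Position → (ℕ → ℕ → Set) → Set
RunMove m s _∼_ = ∃[ s′ ] PositionMove m s s′ × positionFulls s′ ≡ positionFulls s ×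
  positionWeight s ∼ positionWeight s′

odd-class : ∀ c → Even (weight c) ⊎ ∃[ ℓs ] c ≡ runs ℓs × MoveBy 3 _≡_ ℓs × MoveBy 1 _≡_ ℓs
odd-class full      = inj₁ (0 , refl)
odd-class (runs ℓs) with even⊎exact-moves ℓs
... | inj₁ even  = inj₁ even
... | inj₂ moves = inj₂ (ℓs , refl , moves)

positive-class : ∀ c → 0 < weight c → ∃[ ℓs ] c ≡ runs ℓs × MoveBy 2 _≥_ ℓs × MoveBy 2 _≤_ ℓs
positive-class (runs ℓs) 0<w = ℓs , refl , fast-move ℓs 0<w , slow-move ℓs 0<w

-- If some run has length ≡ 2 (mod 3), its class offers drops of exactly 3 and 1, whatever the
-- parity of W. Otherwise both class weights are even, hence so is W, and a class of positive weight
-- offers drops of at least 2 and at most 2.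
run-moves : ∀ m s → 0 < positionWeight s → RunMove m s FastFrom × RunMove m s SlowFrom
run-moves m (c , e) 0<w with odd-class c | odd-class e
... | inj₂ (ℓs , refl , (_ , ℓs₃ , mv₃ , p₃) , (_ , ℓs₁ , mv₁ , p₁)) | _ =
  ((runs ℓs₃ , e) , move₀ (move-runs mv₃) , refl , inj₁ (cong (_+ weight e) p₃)) ,
  ((runs ℓs₁ , e) , move₀ (move-runs mv₁) , refl , inj₁ (cong (_+ weight e) p₁))
... | inj₁ _ | inj₂ (ℓs , refl , (_ , ℓs₃ , mv₃ , p₃) , (_ , ℓs₁ , mv₁ , p₁)) =
  ((c , runs ℓs₃) , move₁ (move-runs mv₃) , refl ,
    inj₁ (trans (cong (weight c +_) p₃) (+-left-comm 3 (weight c) _))) ,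
  ((c , runs ℓs₁) , move₁ (move-runs mv₁) , refl ,
    inj₁ (trans (cong (weight c +_) p₁) (+-left-comm 1 (weight c) _)))
... | inj₁ even₀ | inj₁ even₁ with 0 <? weight c
...   | yes 0<wc with positive-class c 0<wc
...     | (ℓs , refl , (_ , ℓs₂ , mv₂ , p₂) , (_ , ℓs₁ , mv₁ , p₁)) =
  ((runs ℓs₂ , e) , move₀ (move-runs mv₂) , refl ,
    inj₂ (even-+ even₀ even₁ , +-monoˡ-≤ (weight e) p₂)) ,
  ((runs ℓs₁ , e) , move₀ (move-runs mv₁) , refl ,
    inj₂ (even-+ even₀ even₁ , +-monoˡ-≤ (weight e) p₁))
run-moves m (c , e) 0<w | inj₁ even₀ | inj₁ even₁ | no wc≯0
  with positive-class e (subst (λ w → 0 < w + weight e) (n≤0⇒n≡0 (≮⇒≥ wc≯0)) 0<w)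
... | (ℓs , refl , (_ , ℓs₂ , mv₂ , p₂) , (_ , ℓs₁ , mv₁ , p₁)) =
  ((c , runs ℓs₂) , move₁ (move-runs mv₂) , refl ,
    inj₂ (even-+ even₀ even₁ ,
      ≤-trans (≤-reflexive (sym (+-left-comm 2 (weight c) _))) (+-monoʳ-≤ (weight c) p₂))) ,
  ((c , runs ℓs₁) , move₁ (move-runs mv₁) , refl ,
    inj₂ (even-+ even₀ even₁ ,
      ≤-trans (+-monoʳ-≤ (weight c) p₁) (≤-reflexive (+-left-comm 2 (weight c) _))))

fulls-weight : ∀ c → fulls c ≡ 1 → weight c ≡ 0
fulls-weight full _ = refl

-- Here the class has length 3k + 4, so an opening leaves a run of length 3k + 2, the residue with
-- weight 4k + 3.
opened-weight : ∀ k → runsWeight (0 ∷ 2 + k * 3 ∷ []) ≡ k * 4 + 3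
opened-weight k = trans (+-identityʳ _) (trans (runWeight-residue 2 k) (+-comm 3 (k * 4)))

progress : ∀ {k s s′} → PositionMove (2 + k * 3) s s′ →
  Progress k (positionFulls s) (positionWeight s) (positionFulls s′) (positionWeight s′)
progress {k} (move₀ {e = e} open-full) =
  opens refl (fulls≤1 e) (fulls-weight e)
    (trans (cong (_+ weight e) (opened-weight k)) (+-assoc (k * 4) 3 _))
progress {k} (move₁ {c = c} open-full) =
  opens (+-suc (fulls c) 0) (≤-trans (≤-reflexive (+-identityʳ _)) (fulls≤1 c))
    (λ f≡1 → trans (+-identityʳ _) (fulls-weight c (trans (sym (+-identityʳ _)) f≡1)))
    (trans (cong (weight c +_) (opened-weight k)) (lem (weight c) (k * 4)))
  where
  lem : ∀ x y → x + (y + 3) ≡ y + (3 + (x + 0))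
  lem = solve-∀
progress (move₀ {e = e} (move-runs mv)) =
  run (fulls≤1 e) (+-monoˡ-≤ (weight e) (move-decreases mv)) (+-monoˡ-≤ (weight e) (move-decreases-≤3 mv))
progress (move₁ {c = c} (move-runs mv)) =
  run (≤-trans (≤-reflexive (+-identityʳ _)) (fulls≤1 c))
    (+-monoʳ-< (weight c) (move-decreases mv))
    (≤-trans (+-monoʳ-≤ (weight c) (move-decreases-≤3 mv)) (≤-reflexive (+-left-comm 3 (weight c) _)))

weight⇒fulls≤1 : ∀ s → 0 < positionWeight s → positionFulls s ≤ 1
weight⇒fulls≤1 (full , runs _) _ = ≤-refl
weight⇒fulls≤1 (runs _ , e) _    = fulls≤1 e

module PositionValue (k : ℕ) where
  open Value k

  positionValue : Player → Position → ℕ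
  positionValue p s = val p (positionFulls s) (positionWeight s)

  Terminal : Position → Set
  Terminal s = positionFulls s ≡ 0 × positionWeight s ≡ 0

  terminal-value : ∀ p {s} → Terminal s → positionValue p s ≡ 0
  terminal-value Dominator (f≡0 , w≡0) rewrite f≡0 | w≡0 = refl
  terminal-value Staller   (f≡0 , w≡0) rewrite f≡0 | w≡0 = refl

  -- For each player to move, a move that attains the value; the opposite inequalities, for all
  -- moves, are `dominator-all` and `staller-all`.
  OptimalMoves : Position → Set
  OptimalMoves s =
    (∃[ s′ ] PositionMove (2 + k * 3) s s′ × suc (positionValue Staller s′) ≤ positionValue Dominator s) ×
    (∃[ s′ ] PositionMove (2 + k * 3) s s′ × positionValue Staller s ≤ suc (positionValue Dominator s′))

  open-optimal : ∀ {s s′ f} → PositionMove (2 + k * 3) s s′ → f ≤ 1 →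
    positionFulls s ≡ suc f → positionWeight s ≡ 0 →
    positionFulls s′ ≡ f → positionWeight s′ ≡ k * 4 + 3 → OptimalMoves s
  open-optimal {s} {s′} mv f≤1 e₁ e₂ e₃ e₄ = (s′ , mv , dominator) , (s′ , mv , staller)
    where
    dominator : suc (positionValue Staller s′) ≤ positionValue Dominator s
    dominator rewrite e₁ | e₂ | e₃ | e₄ = dominator-open f≤1
    staller : positionValue Staller s ≤ suc (positionValue Dominator s′)
    staller rewrite e₁ | e₂ | e₃ | e₄ = staller-open f≤1

  -- While W > 0, a move inside runs is optimal for either player even if an untouched class
  -- remains. Openings are chosen only once W = 0.
  terminal⊎optimal : ∀ s → Terminal s ⊎ OptimalMoves s
  terminal⊎optimal s with 0 <? positionWeight s
  terminal⊎optimal s | yes 0<w with run-moves (2 + k * 3) s 0<w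
  ... | (s₁ , mv₁ , f₁ , p₁) , (s₂ , mv₂ , f₂ , p₂) = inj₂ ((s₁ , mv₁ , dominator) , (s₂ , mv₂ , staller))
    where
    f≤1 : positionFulls s ≤ 1
    f≤1 = weight⇒fulls≤1 s 0<w
    dominator : suc (positionValue Staller s₁) ≤ positionValue Dominator s
    dominator rewrite f₁ = dominator-run f≤1 p₁
    staller : positionValue Staller s ≤ suc (positionValue Dominator s₂)
    staller rewrite f₂ = staller-run f≤1 p₂
  terminal⊎optimal s | no w≯0 = finish s (n≤0⇒n≡0 (≮⇒≥ w≯0))
    where
    finish : ∀ s → positionWeight s ≡ 0 → Terminal s ⊎ OptimalMoves s
    finish (runs _ , runs _) w≡0 = inj₁ (refl , w≡0)
    finish (full , e) w≡0 = inj₂ (open-optimal (move₀ open-full) (fulls≤1 e) refl w≡0 refl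
      (trans (cong (runsWeight (0 ∷ 2 + k * 3 ∷ []) +_) w≡0)
        (trans (+-identityʳ _) (opened-weight k))))
    finish (runs ℓs , full) w≡0 = inj₂ (open-optimal {f = 0} (move₁ open-full) z≤n refl w≡0 refl
      (trans (cong (_+ runsWeight (0 ∷ 2 + k * 3 ∷ [])) (trans (sym (+-identityʳ _)) w≡0)) (opened-weight k)))

-- Games on graphs

⊓-fold-≥ : ∀ {A : Set} (f : A → ℕ) x v vs → (∀ {u} → u ∈ v ∷ vs → x ≤ f u) →
  x ≤ foldr (λ u r → f u ⊓ r) (f v) vs
⊓-fold-≥ f x v []       h = h (here refl)
⊓-fold-≥ f x v (u ∷ us) h = ⊓-glb (h (there (here refl)))
  (⊓-fold-≥ f x v us λ { (here e) → h (here e) ; (there i) → h (there (there i)) })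

⊓-fold-≤ : ∀ {A : Set} (f : A → ℕ) {u} v vs → u ∈ v ∷ vs → foldr (λ u r → f u ⊓ r) (f v) vs ≤ f u
⊓-fold-≤ f v []       (here refl)         = ≤-refl
⊓-fold-≤ f v (w ∷ vs) (here refl)         = ≤-trans (m⊓n≤n (f w) _) (⊓-fold-≤ f v vs (here refl))
⊓-fold-≤ f v (w ∷ vs) (there (here refl)) = m⊓n≤m (f w) _
⊓-fold-≤ f v (w ∷ vs) (there (there i))   = ≤-trans (m⊓n≤n (f w) _) (⊓-fold-≤ f v vs (there i))

⊔-fold-≤ : ∀ {A : Set} (f : A → ℕ) x v vs → (∀ {u} → u ∈ v ∷ vs → f u ≤ x) →
  foldr (λ u r → f u ⊔ r) (f v) vs ≤ x
⊔-fold-≤ f x v []       h = h (here refl)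
⊔-fold-≤ f x v (u ∷ us) h = ⊔-lub (h (there (here refl)))
  (⊔-fold-≤ f x v us λ { (here e) → h (here e) ; (there i) → h (there (there i)) })

⊔-fold-≥ : ∀ {A : Set} (f : A → ℕ) {u} v vs → u ∈ v ∷ vs → f u ≤ foldr (λ u r → f u ⊔ r) (f v) vs
⊔-fold-≥ f v []       (here refl)         = ≤-refl
⊔-fold-≥ f v (w ∷ vs) (here refl)         = ≤-trans (⊔-fold-≥ f v vs (here refl)) (m≤n⊔m (f w) _)
⊔-fold-≥ f v (w ∷ vs) (there (here refl)) = m≤m⊔n (f w) _
⊔-fold-≥ f v (w ∷ vs) (there (there i))   = ≤-trans (⊔-fold-≥ f v vs (there i)) (m≤n⊔m (f w) _)

≤-suc-pred : ∀ n → n ≤ suc (pred n)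
≤-suc-pred zero    = z≤n
≤-suc-pred (suc n) = ≤-refl

module _ (G : Graph) (D : VSet (order G)) where

  legal⇒∈ : ∀ {v} → T (legal G D v) → v ∈ legalMoves G D
  legal⇒∈ {v} = ∈-filter⁺ (λ v → T? (legal G D v)) (∈-allFin v)

  ∈⇒legal : ∀ {v} → v ∈ legalMoves G D → T (legal G D v)
  ∈⇒legal {v} i = proj₂ (∈-filter⁻ (λ v → T? (legal G D v)) {xs = allFin (order G)} i)

  value-stuck : ∀ p fuel → (∀ v → ¬ T (legal G D v)) → value G fuel p D ≡ 0
  value-stuck p zero       stuck = refl
  value-stuck p (suc fuel) stuck with legalMoves G D in eq
  ... | []     = refl
  ... | v ∷ _ = contradiction (∈⇒legal (subst (v ∈_) (sym eq) (here refl))) (stuck v)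

  -- Reduces a minimum over the list of legal moves to the two halves of a strategy argument: a
  -- bound on every move and one move attaining it. `value-staller` is the dual.
  value-dominator : ∀ fuel x → (∀ v → T (legal G D v) → x ≤ suc (value G fuel Staller (play G D v))) →
    (∃[ v ] T (legal G D v) × suc (value G fuel Staller (play G D v)) ≤ x) →
    value G (suc fuel) Dominator D ≡ x
  value-dominator fuel x all (u , lu , u≤x) with legalMoves G D in eq
  ... | [] = contradiction (subst (u ∈_) eq (legal⇒∈ lu)) λ ()
  ... | v ∷ vs = ≤-antisym
    (≤-trans (s≤s (⊓-fold-≤ (λ u → value G fuel Staller (play G D u)) v vs (subst (u ∈_) eq (legal⇒∈ lu)))) u≤x)
    -- The bound `x ≤ suc r` enters the fold as `pred x ≤ r`, since `suc` stands outside the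
    -- minimum.
    (≤-trans (≤-suc-pred x) (s≤s (⊓-fold-≥ (λ u → value G fuel Staller (play G D u)) (pred x) v vs
      λ {w} i → pred-mono-≤ (all w (∈⇒legal (subst (w ∈_) (sym eq) i))))))

  value-staller : ∀ fuel x → (∀ v → T (legal G D v) → suc (value G fuel Dominator (play G D v)) ≤ x) →
    (∃[ v ] T (legal G D v) × x ≤ suc (value G fuel Dominator (play G D v))) →
    value G (suc fuel) Staller D ≡ x
  value-staller fuel x all (u , lu , x≤u) with legalMoves G D in eq
  ... | [] = contradiction (subst (u ∈_) eq (legal⇒∈ lu)) λ ()
  ... | v ∷ vs = ≤-antisym
    (fold< x (⊔-fold-≤ (λ u → value G fuel Dominator (play G D u)) (pred x) v vs
      λ {w} i → pred-mono-≤ (all w (∈⇒legal (subst (w ∈_) (sym eq) i)))) (all u lu))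
    (≤-trans x≤u (s≤s (⊔-fold-≥ (λ u → value G fuel Dominator (play G D u)) v vs (subst (u ∈_) eq (legal⇒∈ lu)))))
    where
    -- Recovering `suc y ≤ x` from `y ≤ pred x` needs `x` positive; the bound at the legal move `u`
    -- ensures this.
    fold< : ∀ x {y z} → y ≤ pred x → suc z ≤ x → suc y ≤ x
    fold< (suc x) y≤ _ = s≤s y≤

-- `sound` and `complete` make `Represents` a bisimulation between play on the graph and moves of
-- positions, which is all that the transfer of values requires.
module Simulation (G : Graph) (k : ℕ) (Represents : VSet (order G) → Position → Set)
  (sound : ∀ {D s v} → Represents D s → T (legal G D v) →
    ∃[ s′ ] PositionMove (2 + k * 3) s s′ × Represents (play G D v) s′)
  (complete : ∀ {D s s′} → Represents D s → PositionMove (2 + k * 3) s s′ →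
    ∃[ v ] T (legal G D v) × Represents (play G D v) s′)
  where
  open Value k
  open PositionValue k

  value≡positionValue : ∀ fuel p {D s} → Represents D s → positionUncovered (2 + k * 3) s ≤ fuel →
    value G fuel p D ≡ positionValue p s
  value≡positionValue fuel p {D} {s} rep u≤fuel with terminal⊎optimal s
  -- A legal move would, by `sound`, give a `Progress` from `f` = 0 and `w` = 0, but nothing is left
  -- to open or to lower.
  ... | inj₁ terminal = trans (value-stuck G D p fuel stuck) (sym (terminal-value p {s} terminal))
    where
    no-progress : ∀ {f w f′ w′} → f ≡ 0 × w ≡ 0 → ¬ Progress k f w f′ w′
    no-progress (refl , refl) (run _ () _)
    no-progress (refl , refl) (opens () _ _ _)
    stuck : ∀ v → ¬ T (legal G D v)
    stuck v l with sound rep l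
    ... | _ , mv , _ = no-progress terminal (progress mv)
  value≡positionValue zero p {s = s} rep u≤fuel | inj₂ ((_ , mv , _) , _) =
    contradiction (≤-trans (positionMove-uncovered mv) u≤fuel) λ ()
  value≡positionValue (suc fuel) Dominator {D} {s} rep u≤fuel | inj₂ ((s₁ , mv₁ , best) , _) =
    value-dominator G D fuel _ all (v₁ , l₁ , subst (λ x → suc x ≤ _) (sym (next mv₁ rep₁)) best)
    where
    next : ∀ {s′ v} → PositionMove (2 + k * 3) s s′ → Represents (play G D v) s′ →
      value G fuel Staller (play G D v) ≡ positionValue Staller s′
    next mv rep′ = value≡positionValue fuel Staller rep′ (≤-pred (≤-trans (positionMove-uncovered mv) u≤fuel))
    all : ∀ v → T (legal G D v) → positionValue Dominator s ≤ suc (value G fuel Staller (play G D v))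
    all v l with sound rep l
    ... | _ , mv , rep′ rewrite next mv rep′ = dominator-all (progress mv)
    reply = complete rep mv₁
    v₁ = proj₁ reply
    l₁ = proj₁ (proj₂ reply)
    rep₁ = proj₂ (proj₂ reply)
  value≡positionValue (suc fuel) Staller {D} {s} rep u≤fuel | inj₂ (_ , (s₁ , mv₁ , best)) =
    value-staller G D fuel _ all (v₁ , l₁ , subst (λ x → _ ≤ suc x) (sym (next mv₁ rep₁)) best)
    where
    next : ∀ {s′ v} → PositionMove (2 + k * 3) s s′ → Represents (play G D v) s′ →
      value G fuel Dominator (play G D v) ≡ positionValue Dominator s′
    next mv rep′ = value≡positionValue fuel Dominator rep′ (≤-pred (≤-trans (positionMove-uncovered mv) u≤fuel))
    all : ∀ v → T (legal G D v) → suc (value G fuel Dominator (play G D v)) ≤ positionValue Staller s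
    all v l with sound rep l
    ... | _ , mv , rep′ rewrite next mv rep′ = staller-all (progress mv)
    reply = complete rep mv₁
    v₁ = proj₁ reply
    l₁ = proj₁ (proj₂ reply)
    rep₁ = proj₂ (proj₂ reply)

-- Words with prescribed runs

Word : Set
Word = ℕ → Bool

-- Each gap is counted with the covered letter before it. The closing covered letter is left out,
-- because on a cycle it is the initial one again.
span : List ℕ → ℕ
span []       = 0
span (ℓ ∷ ℓs) = suc ℓ + span ℓs

-- The word reads true, ℓ₁ × false, true, ℓ₂ × false, …, true from position 0.
data Reads (g : Word) : List ℕ → Set where
  end  : g 0 ≡ true → Reads g []
  gap  : ∀ {ℓ ℓs} → g 0 ≡ true → (∀ {i} → i < ℓ → g (suc i) ≡ false) →
         Reads (λ i → g (suc ℓ + i)) ℓs → Reads g (ℓ ∷ ℓs)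

reads-head : ∀ {g ℓs} → Reads g ℓs → g 0 ≡ true
reads-head (end e)     = e
reads-head (gap e _ _) = e

-- Positions 0 and `n` will be the same letter of a cyclic word, and a move at `n` - 1 reaches it;
-- therefore `spares` speaks only of positions strictly between them.
record Covers (g : Word) (i n : ℕ) (g′ : Word) : Set where
  field
    coverˡ : g′ i ≡ true
    coverʳ : g′ (suc i) ≡ true
    keeps  : ∀ j → g j ≡ true → g′ j ≡ true
    spares : ∀ j → 0 < j → j < n → g j ≡ false → j ≢ i → j ≢ suc i → g′ j ≡ false

open Covers

covers-shift : ∀ {g i n g′} ℓ → Covers g (suc ℓ + i) (suc ℓ + n) g′ →
  Covers (λ j → g (suc ℓ + j)) i n (λ j → g′ (suc ℓ + j))
covers-shift {i = i} {g′ = g′} ℓ c = record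
  { coverˡ = coverˡ c
  ; coverʳ = trans (cong (λ x → g′ (suc x)) (+-suc ℓ i)) (coverʳ c)
  ; keeps  = λ j → keeps c (suc ℓ + j)
  ; spares = λ j _ j<n gj j≢i j≢si → spares c (suc ℓ + j) (s≤s z≤n) (+-monoʳ-< (suc ℓ) j<n) gj
      (λ e → j≢i (+-cancelˡ-≡ (suc ℓ) j i e))
      (λ e → j≢si (+-cancelˡ-≡ (suc ℓ) j (suc i) (trans e (sym (+-suc (suc ℓ) i)))))
  }

reads-frame : ∀ {g g′ ℓs} → (∀ j → g j ≡ true → g′ j ≡ true) →
  (∀ j → 0 < j → j < span ℓs → g j ≡ false → g′ j ≡ false) → Reads g ℓs → Reads g′ ℓs
reads-frame t f (end e) = end (t 0 e)
reads-frame {ℓs = ℓ ∷ ℓs} t f (gap e z r) = gap (t 0 e)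
  (λ {i} i<ℓ → f (suc i) (s≤s z≤n) (s≤s (≤-trans i<ℓ (m≤m+n ℓ (span ℓs)))) (z i<ℓ))
  (reads-frame (λ j → t (suc ℓ + j))
    (λ j _ j<n → f (suc ℓ + j) (s≤s z≤n) (+-monoʳ-< (suc ℓ) j<n)) r)

-- A move at `i ≤ ℓ` reaches at most position `suc ℓ`, the covered letter that closes the first gap,
-- so the later gaps stay intact.
reads-later : ∀ {g i ℓ ℓs g′} → Covers g i (suc ℓ + span ℓs) g′ → i ≤ ℓ →
  Reads (λ j → g (suc ℓ + j)) ℓs → Reads (λ j → g′ (suc ℓ + j)) ℓs
reads-later {ℓ = ℓ} c i≤ℓ = reads-frame (λ j → keeps c (suc ℓ + j))
  (λ { (suc j) _ j<n gj → spares c (suc ℓ + suc j) (s≤s z≤n) (+-monoʳ-< (suc ℓ) j<n) gj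
     (>⇒≢ (s≤s (≤-trans i≤ℓ (m≤m+n ℓ (suc j)))))
     (>⇒≢ (s≤s (≤-trans (s≤s i≤ℓ) (≤-trans (s≤s (m≤m+n ℓ j)) (≤-reflexive (sym (+-suc ℓ j))))))) })

move-span : ∀ {i ℓs ℓs′} → Move i ℓs ℓs′ → span ℓs′ ≡ span ℓs
move-span left             = refl
move-span right            = cong suc (+-suc _ _)
move-span (mid {a} {b} {ℓs}) = cong suc (lem a b (span ℓs))
  where
  lem : ∀ a b x → a + (1 + (1 + (b + x))) ≡ 2 + ((a + b) + x)
  lem = solve-∀
move-span (there {ℓ = ℓ} mv) = cong (suc ℓ +_) (move-span mv)

Uncovered : Word → ℕ → Set
Uncovered g i = g i ≡ false ⊎ g (suc i) ≡ false

move-uncovered : ∀ {g i ℓs ℓs′} → Move i ℓs ℓs′ → Reads g ℓs → i < span ℓs × Uncovered g i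
move-uncovered left  (gap _ z _) = s≤s z≤n , inj₂ (z (s≤s z≤n))
move-uncovered right (gap _ z _) = s≤s (s≤s (m≤m+n _ _)) , inj₁ (z ≤-refl)
move-uncovered (mid {a} {b} {ℓs}) (gap _ z _) =
  s≤s (s≤s (≤-trans (m≤m+n a b) (≤-trans (m≤m+n (a + b) (span ℓs)) (n≤1+n _)))) ,
  inj₁ (z (s≤s (≤-trans (m≤m+n a b) (n≤1+n _))))
move-uncovered {g} (there {i} {ℓ} mv) (gap _ _ r) with move-uncovered mv r
... | i<n , inj₁ u = +-monoʳ-< (suc ℓ) i<n , inj₁ u
... | i<n , inj₂ u = +-monoʳ-< (suc ℓ) i<n , inj₂ (trans (cong (λ x → g (suc x)) (sym (+-suc ℓ i))) u)

data Locate (ℓ : ℕ) : ℕ → Set where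
  inside : ∀ {i} → i ≤ ℓ → Locate ℓ i
  beyond : ∀ i → Locate ℓ (suc ℓ + i)

locate : ∀ ℓ i → Locate ℓ i
locate ℓ i with i ≤? ℓ
... | yes i≤ℓ = inside i≤ℓ
... | no  i≰ℓ = subst (Locate ℓ) (m+[n∸m]≡n (≰⇒> i≰ℓ)) (beyond (i ∸ suc ℓ))

true≢false : ∀ {b} → b ≡ true → b ≢ false
true≢false refl ()

-- Relative to a gap of length ℓ with its covered letter at 0, index 0 takes the first letter, index
-- ℓ the last, and an index in between two inner letters.
uncovered-move : ∀ {g ℓs i} → Reads g ℓs → i < span ℓs → Uncovered g i → ∃[ ℓs′ ] Move i ℓs ℓs′
uncovered-move {g} {ℓ ∷ ℓs} {i} (gap e z r) i<n u with locate ℓ i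
... | beyond i′ with uncovered-move r (+-cancelˡ-< (suc ℓ) i′ (span ℓs) i<n)
                      (subst (λ x → g (suc ℓ + i′) ≡ false ⊎ g (suc x) ≡ false) (sym (+-suc ℓ i′)) u)
...   | ℓs′ , mv = ℓ ∷ ℓs′ , there mv
uncovered-move {g} {ℓ ∷ ℓs} {zero} (gap e z r) i<n (inj₁ u) | inside _ = contradiction u (true≢false e)
uncovered-move {g} {zero ∷ ℓs} {zero} (gap e z r) i<n (inj₂ u) | inside _ =
  contradiction u (true≢false (reads-head r))
uncovered-move {g} {suc ℓ ∷ ℓs} {zero} (gap e z r) i<n (inj₂ u) | inside _ = 0 ∷ ℓ ∷ ℓs , left
uncovered-move {g} {suc ℓ ∷ ℓs} {suc a} (gap e z r) i<n u | inside (s≤s a≤ℓ) with m≤n⇒m<n∨m≡n a≤ℓ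
... | inj₂ refl = a ∷ 0 ∷ ℓs , right
-- The gap has length `2 + n`; `a` letters remain before the two covered ones and `n ∸ a` after
-- them.
... | inj₁ (s≤s {n = n} a≤n) = a ∷ 0 ∷ n ∸ a ∷ ℓs ,
  subst (λ x → Move (suc a) (2 + x ∷ ℓs) (a ∷ 0 ∷ n ∸ a ∷ ℓs)) (m+[n∸m]≡n a≤n) mid

move-reads : ∀ {g i ℓs ℓs′ g′} → Move i ℓs ℓs′ → Reads g ℓs → Covers g i (span ℓs) g′ → Reads g′ ℓs′
move-reads (left {b} {ℓs}) (gap e z r) c = gap (coverˡ c) (λ ())
  (gap (coverʳ c)
    (λ {i} i<b → spares c (2 + i) (s≤s z≤n) (s≤s (s≤s (≤-trans i<b (m≤m+n b (span ℓs))))) (z (s≤s i<b)) (λ ()) (λ ()))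
    (reads-later c z≤n r))
move-reads {g′ = g′} (right {a} {ℓs}) (gap e z r) c = gap (keeps c 0 e)
  (λ {i} i<a → spares c (suc i) (s≤s z≤n) (s≤s (≤-trans i<a (≤-trans (m≤m+n a (span ℓs)) (n≤1+n _))))
    (z (≤-trans i<a (n≤1+n a))) (<⇒≢ (s≤s i<a)) (<⇒≢ (s≤s (≤-trans i<a (n≤1+n a)))))
  (gap (trans (cong (λ x → g′ (suc x)) (+-identityʳ a)) (coverˡ c)) (λ ())
    (reads-frame (λ j p → trans (cong (λ x → g′ (suc x)) (+-suc a j)) p)
      (λ j _ _ p → trans (cong (λ x → g′ (suc x)) (+-suc a j)) p)
      (reads-later c ≤-refl r)))
move-reads {g} {g′ = g′} (mid {a} {b} {ℓs}) (gap e z r) c = gap (keeps c 0 e)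
  (λ {i} i<a → spares c (suc i) (s≤s z≤n)
    (s≤s (≤-trans i<a (≤-trans (m≤m+n a b) (≤-trans (m≤m+n (a + b) (span ℓs)) (m≤n+m _ 2)))))
    (z (≤-trans i<a (≤-trans (m≤m+n a b) (m≤n+m _ 2))))
    (<⇒≢ (s≤s i<a)) (<⇒≢ (s≤s (≤-trans i<a (n≤1+n a)))))
  (gap (trans (cong (λ x → g′ (suc x)) (+-identityʳ a)) (coverˡ c)) (λ ())
    (gap (trans (cong (λ x → g′ (suc x)) (+-comm a 1)) (coverʳ c))
      (λ {i} i<b → trans (cong (λ x → g′ (suc x)) (lem₁ a i))
        (spares c (3 + (a + i)) (s≤s z≤n)
          (s≤s (s≤s (s≤s (≤-trans (≤-reflexive (sym (+-suc a i))) (≤-trans (+-monoʳ-≤ a i<b) (m≤m+n (a + b) (span ℓs)))))))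
          (z (s≤s (s≤s (≤-trans (≤-reflexive (sym (+-suc a i))) (+-monoʳ-≤ a i<b)))))
          (>⇒≢ (s≤s (s≤s (≤-trans (m≤m+n a i) (n≤1+n _)))))
          (>⇒≢ (s≤s (s≤s (s≤s (m≤m+n a i)))))))
      (reads-frame (λ j p → trans (cong (λ x → g′ (suc x)) (lem₂ a b j)) p)
        (λ j _ _ p → trans (cong (λ x → g′ (suc x)) (lem₂ a b j)) p)
        (reads-later c (s≤s (≤-trans (m≤m+n a b) (n≤1+n _))) r))))
  where
  lem₁ : ∀ a i → a + (1 + (1 + i)) ≡ 2 + (a + i)
  lem₁ = solve-∀
  lem₂ : ∀ a b j → a + (1 + (1 + (b + j))) ≡ 2 + ((a + b) + j)
  lem₂ = solve-∀
move-reads (there {ℓ = ℓ} {ℓs} mv) (gap e z r) c = gap (keeps c 0 e)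
  (λ {i} i<ℓ → spares c (suc i) (s≤s z≤n) (s≤s (≤-trans i<ℓ (m≤m+n ℓ (span ℓs)))) (z i<ℓ)
    (<⇒≢ (s≤s (≤-trans i<ℓ (m≤m+n ℓ _)))) (<⇒≢ (s≤s (≤-trans i<ℓ (≤-trans (m≤m+n ℓ _) (n≤1+n _))))))
  (move-reads mv r (covers-shift ℓ c))

-- Congruences

-- A record rather than a definition, so that a and b can be inferred.
record _≈_[mod_] (a b n : ℕ) .{{_ : NonZero n}} : Set where
  constructor rem
  field %-≡ : a % n ≡ b % n

infix 4 _≈_[mod_]

module _ {n : ℕ} .{{_ : NonZero n}} where

  ≈-refl : ∀ {a} → a ≈ a [mod n ]
  ≈-refl = rem refl

  ≈-reflexive : ∀ {a b} → a ≡ b → a ≈ b [mod n ]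
  ≈-reflexive refl = ≈-refl

  ≈-sym : ∀ {a b} → a ≈ b [mod n ] → b ≈ a [mod n ]
  ≈-sym (rem p) = rem (sym p)

  ≈-trans : ∀ {a b c} → a ≈ b [mod n ] → b ≈ c [mod n ] → a ≈ c [mod n ]
  ≈-trans (rem p) (rem q) = rem (trans p q)

  ≈-% : ∀ a → a % n ≈ a [mod n ]
  ≈-% a = rem (m%n%n≡m%n a n)

  -- A subtraction-free form of congruence: each number is increased by the multiple of `n`
  -- contained in the other.
  ≈⇒+-≡ : ∀ {a b} → a ≈ b [mod n ] → a + b / n * n ≡ b + a / n * n
  ≈⇒+-≡ {a} {b} (rem e) = begin
    a + b / n * n                     ≡⟨ cong (_+ b / n * n) (m≡m%n+[m/n]*n a n) ⟩
    a % n + a / n * n + b / n * n     ≡⟨ cong (λ r → r + a / n * n + b / n * n) e ⟩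
    b % n + a / n * n + b / n * n     ≡⟨ swap (b % n) (a / n * n) (b / n * n) ⟩
    b % n + b / n * n + a / n * n     ≡⟨ cong (_+ a / n * n) (m≡m%n+[m/n]*n b n) ⟨
    b + a / n * n                     ∎
    where
    open ≡-Reasoning
    swap : ∀ x y z → x + y + z ≡ x + z + y
    swap = solve-∀

  ≈-+* : ∀ a k → a + k * n ≈ a [mod n ]
  ≈-+* a k = rem ([m+kn]%n≡m%n a k n)

  +-≡⇒≈ : ∀ {a b} p q → a + p * n ≡ b + q * n → a ≈ b [mod n ]
  +-≡⇒≈ {a} {b} p q e = ≈-trans (≈-sym (≈-+* a p)) (≈-trans (≈-reflexive e) (≈-+* b q))

  ≈-cancelˡ : ∀ c {a b} → c + a ≈ c + b [mod n ] → a ≈ b [mod n ]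
  ≈-cancelˡ c {a} {b} p = +-≡⇒≈ ((c + b) / n) ((c + a) / n) (+-cancelˡ-≡ c _ _ (begin
    c + (a + (c + b) / n * n)  ≡⟨ +-assoc c a _ ⟨
    c + a + (c + b) / n * n    ≡⟨ ≈⇒+-≡ p ⟩
    c + b + (c + a) / n * n    ≡⟨ +-assoc c b _ ⟩
    c + (b + (c + a) / n * n)  ∎))
    where open ≡-Reasoning

  ≈-+ˡ : ∀ c {a b} → a ≈ b [mod n ] → c + a ≈ c + b [mod n ]
  ≈-+ˡ c {a} {b} (rem e) =
    rem (trans (%-distribˡ-+ c a n) (trans (cong (λ x → (c % n + x) % n) e) (sym (%-distribˡ-+ c b n))))

  ≈-suc : ∀ {a b} → a ≈ b [mod n ] → suc a ≈ suc b [mod n ]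
  ≈-suc = ≈-+ˡ 1

  ≈⇒≡ : ∀ {a b} → a < n → b < n → a ≈ b [mod n ] → a ≡ b
  ≈⇒≡ a<n b<n (rem e) = trans (sym (m<n⇒m%n≡m a<n)) (trans e (m<n⇒m%n≡m b<n))

-- Cyclic words

module Cyclic (m : ℕ) where

  M : ℕ
  M = 2 + m

  Periodic : Word → Set
  Periodic h = ∀ {i j} → i ≈ j [mod M ] → h i ≡ h j

  -- A cyclic word is unrolled from some covered letter `t`; the condition on `span` says that the
  -- reading goes round exactly once.
  Shows : Word → ClassState → Set
  Shows h full      = ∀ i → h i ≡ false
  Shows h (runs ℓs) = ∃[ t ] Reads (λ i → h (t + i)) ℓs × span ℓs ≡ M

  record CoversCyclic (h : Word) (q : ℕ) (h′ : Word) : Set where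
    field
      onˡ  : h′ q ≡ true
      onʳ  : h′ (suc q) ≡ true
      mono : ∀ j → h j ≡ true → h′ j ≡ true
      off  : ∀ j → h j ≡ false → ¬ j ≈ q [mod M ] → ¬ j ≈ suc q [mod M ] → h′ j ≡ false

  open CoversCyclic

  shows-cong : ∀ {h h′} c → (∀ i → h′ i ≡ h i) → Shows h c → Shows h′ c
  shows-cong full      eq r             = λ i → trans (eq i) (r i)
  shows-cong (runs ℓs) eq (t , r , len) =
    t , reads-frame (λ j → trans (eq (t + j))) (λ j _ _ → trans (eq (t + j))) r , len

  rotate : ∀ t q → ∃[ i ] i < M × t + i ≈ q [mod M ]
  rotate t q = x % M , m%n<n x M ,
    ≈-trans (≈-+ˡ t (≈-% x)) (≈-trans (≈-reflexive (lem t q m)) (≈-+* q t))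
    where
    -- This stands for `q` - `t` modulo `M`, since `t + t * suc m` is `t * M`.
    x = q + t * suc m
    lem : ∀ t q m → t + (q + t * (1 + m)) ≡ q + t * (2 + m)
    lem = solve-∀

  rotate-suc : ∀ {t i q} → t + i ≈ q [mod M ] → t + suc i ≈ suc q [mod M ]
  rotate-suc {t} {i} e = ≈-trans (≈-reflexive (+-suc t i)) (≈-suc e)

  covers-rotated : ∀ {h h′ q t i} → Periodic h′ → t + i ≈ q [mod M ] → i < M →
    CoversCyclic h q h′ → Covers (λ j → h (t + j)) i M (λ j → h′ (t + j))
  covers-rotated {h} {h′} {q} {t} {i} per t+i≈q i<M c = record
    { coverˡ = trans (per t+i≈q) (onˡ c)
    ; coverʳ = trans (per (rotate-suc t+i≈q)) (onʳ c)
    ; keeps  = λ j → mono c (t + j)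
    ; spares = λ j 0<j j<M hj j≢i j≢si → off c (t + j) hj
        (λ e → j≢i (≈⇒≡ j<M i<M (≈-cancelˡ t (≈-trans e (≈-sym t+i≈q)))))
        (λ e → excluded 0<j j<M j≢si (≈-cancelˡ t (≈-trans e (≈-sym (rotate-suc t+i≈q)))))
    }
    where
    -- For `i` = `M` - 1 the letter `suc i` wraps round to 0, which `0 < j` rules out.
    excluded : ∀ {j} → 0 < j → j < M → j ≢ suc i → ¬ j ≈ suc i [mod M ]
    excluded 0<j j<M j≢si e with m≤n⇒m<n∨m≡n i<M
    ... | inj₁ si<M = j≢si (≈⇒≡ j<M si<M e)
    ... | inj₂ refl = >⇒≢ 0<j (≈⇒≡ j<M (s≤s z≤n) (≈-trans e (rem (n%n≡0 M))))

  cover-full : ∀ {h h′ q} → Periodic h′ → Shows h full → CoversCyclic h q h′ → Shows h′ (runs (0 ∷ m ∷ []))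
  cover-full {h} {h′} {q} per empty c =
    q , gap onˡ-rot (λ ()) (gap onʳ-rot off-rot (end end-rot)) , cong (2 +_) (+-identityʳ m)
    where
    onˡ-rot : h′ (q + 0) ≡ true
    onˡ-rot = trans (cong h′ (+-identityʳ q)) (onˡ c)
    onʳ-rot : h′ (q + 1) ≡ true
    onʳ-rot = trans (cong h′ (+-comm q 1)) (onʳ c)
    end-rot : h′ (q + (2 + m + 0)) ≡ true
    end-rot = trans (per (≈-trans (≈-reflexive (lem q m)) (≈-+* q 1))) (onˡ c)
      where
      lem : ∀ q m → q + (2 + m + 0) ≡ q + 1 * (2 + m)
      lem = solve-∀
    off-rot : ∀ {i} → i < m → h′ (q + (2 + i)) ≡ false
    off-rot {i} i<m = off c (q + (2 + i)) (empty _)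
      (λ e → contradiction (≈⇒≡ (s≤s (s≤s i<m)) (s≤s z≤n)
        (≈-cancelˡ q (≈-trans e (≈-reflexive (sym (+-identityʳ q)))))) λ ())
      (λ e → contradiction (≈⇒≡ (s≤s (s≤s i<m)) (s≤s (s≤s z≤n))
        (≈-cancelˡ q (≈-trans e (≈-reflexive (+-comm 1 q))))) λ ())

  cover-runs : ∀ {h h′ q t i ℓs ℓs′} → Periodic h′ → t + i ≈ q [mod M ] → i < M → span ℓs ≡ M →
    Move i ℓs ℓs′ → Reads (λ j → h (t + j)) ℓs → CoversCyclic h q h′ → Shows h′ (runs ℓs′)
  cover-runs {h} {h′} {t = t} {i} per t+i≈q i<M len mv r c =
    t , move-reads mv r (subst (λ n → Covers (λ j → h (t + j)) i n (λ j → h′ (t + j))) (sym len)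
      (covers-rotated per t+i≈q i<M c)) , trans (move-span mv) len

  -- The move is fixed before the new word `h′` is given, so one class can be treated without
  -- reference to the graph.
  class-sound : ∀ {h c q} → Periodic h → Shows h c → Uncovered h q →
    ∃[ c′ ] ClassMove m c c′ × (∀ {h′} → Periodic h′ → CoversCyclic h q h′ → Shows h′ c′)
  class-sound {c = full} per sh u = _ , open-full , λ per′ → cover-full per′ sh
  class-sound {h} {runs ℓs} {q} per (t , r , len) u with rotate t q
  ... | i , i<M , t+i≈q with uncovered-move r (≤-trans i<M (≤-reflexive (sym len))) (rotated u)
    where
    rotated : Uncovered h q → Uncovered (λ j → h (t + j)) i
    rotated (inj₁ e) = inj₁ (trans (per t+i≈q) e)
    rotated (inj₂ e) = inj₂ (trans (per (rotate-suc t+i≈q)) e)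
  ...   | ℓs′ , mv = runs ℓs′ , move-runs mv , λ per′ → cover-runs per′ t+i≈q i<M len mv r

  class-complete : ∀ {h c c′} → Shows h c → ClassMove m c c′ →
    ∃[ q ] Uncovered h q × (∀ {h′} → Periodic h′ → CoversCyclic h q h′ → Shows h′ c′)
  class-complete sh open-full = 0 , inj₁ (sh 0) , λ per′ → cover-full per′ sh
  class-complete {h} (t , r , len) (move-runs {i} mv) with move-uncovered mv r
  ... | i<n , u = t + i , unrotated u , λ per′ → cover-runs per′ ≈-refl (≤-trans i<n (≤-reflexive len)) len mv r
    where
    unrotated : Uncovered (λ j → h (t + j)) i → Uncovered h (t + i)
    unrotated (inj₁ e) = inj₁ e
    unrotated (inj₂ e) = inj₂ (trans (cong h (sym (+-suc t i))) e)

-- The two parity classes of an even cycle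

module EvenCycle (m : ℕ) where
  open Cyclic m

  N : ℕ
  N = M * 2

  G : Graph
  G = Cycle N

  cycSucc≡ : ∀ v → cycSucc N v ≡ suc (toℕ v) % N
  cycSucc≡ v with (toℕ v + 1) ≡ᵇ N in eq
  ... | true  = sym (trans (cong (_% N) (trans (+-comm 1 (toℕ v))
    (≡ᵇ⇒≡ (toℕ v + 1) N (Equivalence.from T-≡ eq)))) (n%n≡0 N))
  ... | false = trans (+-comm (toℕ v) 1) (sym (m<n⇒m%n≡m (≤∧≢⇒< (toℕ<n v)
    λ e → contradiction (trans (sym (Equivalence.to T-≡ (≡⇒≡ᵇ (toℕ v + 1) N (trans (+-comm (toℕ v) 1) e)))) eq) λ ())))

  -- Any natural number names a vertex modulo `N`, so neighbours and arcs need no case distinction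
  -- at the wrap-around.
  _∼_ : Fin N → ℕ → Set
  v ∼ x = toℕ v ≈ x [mod N ]

  cycSucc⇒ : ∀ {v w} → T (cycSucc N v ≡ᵇ toℕ w) → w ∼ suc (toℕ v)
  cycSucc⇒ {v} {w} e = rem (trans (m<n⇒m%n≡m (toℕ<n w)) (trans (sym (≡ᵇ⇒≡ _ _ e)) (cycSucc≡ v)))

  cycSucc⇐ : ∀ {v w} → w ∼ suc (toℕ v) → T (cycSucc N v ≡ᵇ toℕ w)
  cycSucc⇐ {v} {w} (rem e) = ≡⇒≡ᵇ _ _ (trans (cycSucc≡ v) (trans (sym e) (m<n⇒m%n≡m (toℕ<n w))))

  vertex : ℕ → Fin N
  vertex x = x mod N

  vertex-∼ : ∀ x → vertex x ∼ x
  vertex-∼ x = ≈-trans (≈-reflexive (toℕ-fromℕ< (m%n<n x N))) (≈-% x)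

  class : VSet N → ℕ → Word
  class D e i = D (vertex (i * 2 + e))

  class-at : ∀ (D : VSet N) {w} e i → w ∼ (i * 2 + e) → D w ≡ class D e i
  class-at D {w} e i w∼ = cong D (toℕ-injective (≈⇒≡ (toℕ<n w) (toℕ<n (vertex (i * 2 + e)))
    (≈-trans w∼ (≈-sym (vertex-∼ (i * 2 + e))))))

  class-shift : ∀ e i p n → e + (i + p * n) * 2 ≡ i * 2 + e + p * (n * 2)
  class-shift = solve-∀

  class-index : ∀ e {i j} → i * 2 + e ≈ j * 2 + e [mod N ] → i ≈ j [mod M ]
  class-index e {i} {j} i≈j = +-≡⇒≈ p q (*-cancelʳ-≡ _ _ 2 (+-cancelˡ-≡ e _ _
    (trans (class-shift e i p M) (trans (≈⇒+-≡ i≈j) (sym (class-shift e j q M))))))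
    where
    p = (j * 2 + e) / N
    q = (i * 2 + e) / N

  class-periodic : ∀ D e → Periodic (class D e)
  class-periodic D e {i} {j} i≈j = class-at D e j (≈-trans (vertex-∼ (i * 2 + e)) (+-≡⇒≈ (j / M) (i / M)
    (trans (sym (class-shift e i (j / M) M))
      (trans (cong (λ x → e + x * 2) (≈⇒+-≡ i≈j)) (class-shift e j (i / M) M)))))

  -- `N` is even, so congruence modulo `N` preserves parity; the resulting equation is read modulo
  -- 2.
  classes-disjoint : ∀ {e e′ i j} → e < 2 → e′ < 2 → e ≢ e′ → ¬ i * 2 + e ≈ j * 2 + e′ [mod N ]
  classes-disjoint {e} {e′} {i} {j} e<2 e′<2 e≢e′ i≈j = e≢e′ (≈⇒≡ e<2 e′<2
    (+-≡⇒≈ (i + p * M) (j + q * M)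
      (trans (class-shift e i p M) (trans (≈⇒+-≡ i≈j) (sym (class-shift e′ j q M))))))
    where
    p = (j * 2 + e′) / N
    q = (i * 2 + e) / N

  -- The vertices q and q + 1 of class e are the neighbours of v.
  record Edge (v : Fin N) (e q : ℕ) : Set where
    constructor edge
    field centre : v ∼ suc (q * 2 + e)

  data Endpoint (e q : ℕ) (w : Fin N) : ℕ → Set where
    endˡ : w ∼ (q * 2 + e) → Endpoint e q w q
    endʳ : w ∼ (suc q * 2 + e) → Endpoint e q w (suc q)

  endpoint-∼ : ∀ {e q w j} → Endpoint e q w j → w ∼ (j * 2 + e)
  endpoint-∼ (endˡ w∼) = w∼
  endpoint-∼ (endʳ w∼) = w∼

  adj⇒endpoint : ∀ {v e q w} → Edge v e q → T (adj G v w) → ∃[ j ] Endpoint e q w j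
  adj⇒endpoint {v} {e} {q} {w} (edge v∼) a with Equivalence.to (T-∨ {cycSucc N v ≡ᵇ toℕ w}) a
  ... | inj₁ s = suc q , endʳ (≈-trans (cycSucc⇒ {v} {w} s) (≈-suc v∼))
  ... | inj₂ s = q , endˡ (≈-cancelˡ 1 (≈-trans (≈-sym (cycSucc⇒ {w} {v} s)) v∼))

  endpoint⇒adj : ∀ {v e q w j} → Edge v e q → Endpoint e q w j → T (adj G v w)
  endpoint⇒adj {v} {w = w} (edge v∼) (endˡ w∼) = Equivalence.from (T-∨ {cycSucc N v ≡ᵇ toℕ w})
    (inj₂ (cycSucc⇐ {w} {v} (≈-trans v∼ (≈-suc (≈-sym w∼)))))
  endpoint⇒adj {v} {w = w} (edge v∼) (endʳ w∼) = Equivalence.from (T-∨ {cycSucc N v ≡ᵇ toℕ w})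
    (inj₁ (cycSucc⇐ {v} {w} (≈-trans w∼ (≈-suc (≈-sym v∼)))))

  ¬T⇒false : ∀ {b} → ¬ T b → b ≡ false
  ¬T⇒false {false} _ = refl
  ¬T⇒false {true}  f = contradiction _ f

  play-on : ∀ {v w} D → T (adj G v w) → play G D v w ≡ true
  play-on {v} {w} D a = trans (cong (D w ∨_) (Equivalence.to T-≡ a)) (∨-zeroʳ (D w))

  play-off : ∀ {v w} D → ¬ T (adj G v w) → play G D v w ≡ D w
  play-off {v} {w} D ¬a = trans (cong (D w ∨_) (¬T⇒false ¬a)) (∨-identityʳ (D w))

  play-covers : ∀ {v e q} D → Edge v e q → CoversCyclic (class D e) q (class (play G D v) e)
  play-covers {v} {e} {q} D ed = record
    { onˡ  = play-on {v} D (endpoint⇒adj ed (endˡ (vertex-∼ (q * 2 + e))))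
    ; onʳ  = play-on {v} D (endpoint⇒adj ed (endʳ (vertex-∼ (suc q * 2 + e))))
    ; mono = λ j Dj → cong (_∨ adj G v (vertex (j * 2 + e))) Dj
    ; off  = λ j Dj j≉q j≉sq → trans (play-off {v} D λ a → non-endpoint j j≉q j≉sq (proj₂ (adj⇒endpoint ed a))) Dj
    }
    where
    non-endpoint : ∀ j {i} → ¬ j ≈ q [mod M ] → ¬ j ≈ suc q [mod M ] → ¬ Endpoint e q (vertex (j * 2 + e)) i
    non-endpoint j j≉q _ (endˡ w∼) = j≉q (class-index e {j} {q} (≈-trans (≈-sym (vertex-∼ (j * 2 + e))) w∼))
    non-endpoint j _ j≉sq (endʳ w∼) =
      j≉sq (class-index e {j} {suc q} (≈-trans (≈-sym (vertex-∼ (j * 2 + e))) w∼))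

  -- Both neighbours of `v` lie in class `e`, so the other word does not change.
  play-frame : ∀ {v e e′ q} D → e < 2 → e′ < 2 → e ≢ e′ → Edge v e q →
    ∀ i → class (play G D v) e′ i ≡ class D e′ i
  play-frame {v} {e} {e′} {q} D e<2 e′<2 e≢e′ ed i =
    play-off {v} D λ a → off (adj⇒endpoint ed a)
    where
    off : ¬ (∃[ j ] Endpoint e q (vertex (i * 2 + e′)) j)
    off (j , p) = classes-disjoint {e} {e′} {j} {i} e<2 e′<2 e≢e′
      (≈-trans (≈-sym (endpoint-∼ p)) (vertex-∼ (i * 2 + e′)))

  endpoint⇒uncovered : ∀ {D e q w j} → Endpoint e q w j → D w ≡ false → Uncovered (class D e) q
  endpoint⇒uncovered {D} {e} {q} (endˡ w∼) Dw = inj₁ (trans (sym (class-at D e q w∼)) Dw)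
  endpoint⇒uncovered {D} {e} {q} (endʳ w∼) Dw = inj₂ (trans (sym (class-at D e (suc q) w∼)) Dw)

  legal⇒uncovered : ∀ {D v e q} → Edge v e q → T (legal G D v) → Uncovered (class D e) q
  legal⇒uncovered {D} {v} {e} {q} ed l with satisfied (any⁻ (λ w → adj G v w ∧ not (D w)) (allFin N) l)
  ... | w , Tw with Equivalence.to (T-∧ {adj G v w}) Tw
  ... | a , ¬Dw = endpoint⇒uncovered {D} (proj₂ (adj⇒endpoint ed a)) (Equivalence.to T-not-≡ ¬Dw)

  uncovered⇒legal : ∀ {D v e q} → Edge v e q → Uncovered (class D e) q → T (legal G D v)
  uncovered⇒legal {D} {v} {e} {q} ed = λ
    { (inj₁ u) → legal-by (endˡ (vertex-∼ (q * 2 + e))) u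
    ; (inj₂ u) → legal-by (endʳ (vertex-∼ (suc q * 2 + e))) u }
    where
    legal-by : ∀ {w j} → Endpoint e q w j → D w ≡ false → T (legal G D v)
    legal-by {w} p Dw = any⁺ (λ w → adj G v w ∧ not (D w)) (lose (∈-allFin w)
      (Equivalence.from (T-∧ {adj G v w}) (endpoint⇒adj ed p , Equivalence.from T-not-≡ Dw)))

  vertex-edge : ∀ v → (∃[ q ] Edge v 0 q) ⊎ (∃[ q ] Edge v 1 q)
  vertex-edge v = by-parity (x % 2) (m%n<n x 2) refl
    where
    -- The predecessor of `v`, reached by adding `N` - 1 = 2m + 3 so that `v` = 0 is covered too.
    -- Its parity is the class and its half the index.
    x = toℕ v + suc (m * 2 + 2)
    v∼x : v ∼ suc x
    v∼x = ≈-trans (≈-sym (≈-+* (toℕ v) 1)) (≈-reflexive (lem (toℕ v) m))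
      where
      lem : ∀ v m → v + 1 * ((2 + m) * 2) ≡ 1 + (v + (1 + (m * 2 + 2)))
      lem = solve-∀
    edge-of : ∀ r → x % 2 ≡ r → Edge v r (x / 2)
    edge-of r e = edge (≈-trans v∼x (≈-reflexive (cong suc
      (trans (m≡m%n+[m/n]*n x 2) (trans (+-comm (x % 2) _) (cong (x / 2 * 2 +_) e))))))
    by-parity : ∀ r → r < 2 → x % 2 ≡ r → (∃[ q ] Edge v 0 q) ⊎ (∃[ q ] Edge v 1 q)
    by-parity 0 _ e = inj₁ (x / 2 , edge-of 0 e)
    by-parity 1 _ e = inj₂ (x / 2 , edge-of 1 e)
    by-parity (suc (suc _)) (s≤s (s≤s ())) _

  Represents : VSet N → Position → Set
  Represents D (c , e) = Shows (class D 0) c × Shows (class D 1) e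

  sound : ∀ {D s v} → Represents D s → T (legal G D v) →
    ∃[ s′ ] PositionMove m s s′ × Represents (play G D v) s′
  sound {D} {c , e} {v} (r₀ , r₁) l with vertex-edge v
  ... | inj₁ (q , ed) with class-sound {c = c} {q} (class-periodic D 0) r₀ (legal⇒uncovered {D} ed l)
  ...   | c′ , mv , rep = (c′ , e) , move₀ mv ,
    rep (class-periodic (play G D v) 0) (play-covers D ed) ,
    shows-cong e (play-frame D (s≤s z≤n) ≤-refl (λ ()) ed) r₁
  sound {D} {c , e} {v} (r₀ , r₁) l | inj₂ (q , ed)
    with class-sound {c = e} {q} (class-periodic D 1) r₁ (legal⇒uncovered {D} ed l)
  ... | e′ , mv , rep = (c , e′) , move₁ mv ,
    shows-cong c (play-frame D ≤-refl (s≤s z≤n) (λ ()) ed) r₀ ,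
    rep (class-periodic (play G D v) 1) (play-covers D ed)

  complete : ∀ {D s s′} → Represents D s → PositionMove m s s′ →
    ∃[ v ] T (legal G D v) × Represents (play G D v) s′
  complete {D} (r₀ , r₁) (move₀ {c} {c′} {e} mv) with class-complete {class D 0} {c} r₀ mv
  ... | q , u , rep = v , uncovered⇒legal {D} ed u ,
    rep (class-periodic (play G D v) 0) (play-covers D ed) ,
    shows-cong e (play-frame D (s≤s z≤n) ≤-refl (λ ()) ed) r₁
    where
    v = vertex (suc (q * 2 + 0))
    ed : Edge v 0 q
    ed = edge (vertex-∼ (suc (q * 2 + 0)))
  complete {D} (r₀ , r₁) (move₁ {c} {e} {e′} mv) with class-complete {class D 1} {e} r₁ mv
  ... | q , u , rep = v , uncovered⇒legal {D} ed u ,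
    shows-cong c (play-frame D ≤-refl (s≤s z≤n) (λ ()) ed) r₀ ,
    rep (class-periodic (play G D v) 1) (play-covers D ed)
    where
    v = vertex (suc (q * 2 + 1))
    ed : Edge v 1 q
    ed = edge (vertex-∼ (suc (q * 2 + 1)))

-- Predominated pairs

sum≤span : ∀ ℓs → sum ℓs ≤ span ℓs
sum≤span []       = z≤n
sum≤span (ℓ ∷ ℓs) = ≤-trans (+-monoʳ-≤ ℓ (sum≤span ℓs)) (n≤1+n _)

module Pairs (k : ℕ) where
  open Value k
  open PositionValue k
  open Cyclic (2 + k * 3)
  open EvenCycle (2 + k * 3)
  open Simulation G k Represents (λ {D} → sound {D}) (λ {D} → complete {D})

  uncovered≤M : ∀ {h} c → Shows h c → uncovered (2 + k * 3) c ≤ M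
  uncovered≤M full      _             = ≤-refl
  uncovered≤M (runs ℓs) (_ , _ , len) = ≤-trans (sum≤span ℓs) (≤-reflexive len)

  γgt∣≡positionValue : ∀ D s → Represents D s → γgt∣ G D ≡ positionValue Dominator s
  γgt∣≡positionValue D (c , e) (r₀ , r₁) = value≡positionValue N Dominator {D} (r₀ , r₁)
    (≤-trans (+-mono-≤ (uncovered≤M c r₀) (uncovered≤M e r₁)) (≤-reflexive (lem M)))
    where
    lem : ∀ x → x + x ≡ x * 2
    lem = solve-∀

  γgt≡ : γgt G ≡ 5 + k * 4
  γgt≡ = γgt∣≡positionValue (λ _ → false) (full , full) ((λ _ → refl) , (λ _ → refl))

  one-mark : ∀ {h} t → Periodic h → h t ≡ true → (∀ j → ¬ j ≈ t [mod M ] → h j ≡ false) →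
    Shows h (runs (3 + k * 3 ∷ []))
  one-mark {h} t per on off = t ,
    gap (trans (cong h (+-identityʳ t)) on)
      (λ {i} i<ℓ → off (t + suc i) λ e → contradiction
        (≈⇒≡ (s≤s i<ℓ) (s≤s z≤n) (≈-cancelˡ t (≈-trans e (≈-reflexive (sym (+-identityʳ t)))))) λ ())
      (end (trans (per (≈-trans (≈-reflexive (lem t (k * 3))) (≈-+* t 1))) on)) ,
    cong (4 +_) (+-identityʳ (k * 3))
    where
    lem : ∀ t x → t + (4 + x + 0) ≡ t + 1 * (4 + x)
    lem = solve-∀

  two-marks : ∀ {h} t x y → suc x + suc y ≡ M → Periodic h → h t ≡ true → h (t + suc x) ≡ true →
    (∀ j → ¬ j ≈ t [mod M ] → ¬ j ≈ t + suc x [mod M ] → h j ≡ false) → Shows h (runs (x ∷ y ∷ []))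
  two-marks {h} t x y x+y per on₁ on₂ off = t ,
    gap (trans (cong h (+-identityʳ t)) on₁)
      (λ {i} i<x → off-at (suc i) (≤-trans (s≤s i<x) x<M) (λ ()) (<⇒≢ (s≤s i<x)))
      (gap (trans (cong (λ z → h (t + z)) (+-identityʳ (suc x))) on₂)
        (λ {i} i<y → off-at (suc x + suc i) (≤-trans (+-monoʳ-< (suc x) (s≤s i<y)) (≤-reflexive x+y)) (λ ())
          (>⇒≢ (m<m+n (suc x) (s≤s z≤n))))
        (end (trans (per (≈-trans (≈-reflexive wrap) (≈-+* t 1))) on₁))) ,
    trans (cong (λ z → suc x + suc z) (+-identityʳ y)) x+y
    where
    x<M : suc x ≤ M
    x<M = ≤-trans (m≤m+n (suc x) (suc y)) (≤-reflexive x+y)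
    sx<M : suc x < M
    sx<M = ≤-trans (m<m+n (suc x) (s≤s z≤n)) (≤-reflexive x+y)
    off-at : ∀ j → j < M → j ≢ 0 → j ≢ suc x → h (t + j) ≡ false
    off-at j j<M j≢0 j≢sx = off (t + j)
      (λ e → j≢0 (≈⇒≡ j<M (s≤s z≤n) (≈-cancelˡ t (≈-trans e (≈-reflexive (sym (+-identityʳ t)))))))
      (λ e → j≢sx (≈⇒≡ j<M sx<M (≈-cancelˡ t e)))
    wrap : t + (suc x + (suc y + 0)) ≡ t + 1 * M
    wrap = cong (t +_) (trans (cong (suc x +_) (+-identityʳ (suc y))) (trans x+y (sym (*-identityˡ M))))

  -- The predominated pair is named by arbitrary representatives modulo `N`, so the second may be
  -- written `a + d` even beyond `N`.
  record Marks (D : VSet N) (a b : ℕ) : Set where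
    field
      on₁ : ∀ {w} → w ∼ a → D w ≡ true
      on₂ : ∀ {w} → w ∼ b → D w ≡ true
      off : ∀ {w} → ¬ w ∼ a → ¬ w ∼ b → D w ≡ false

  open Marks

  marks-sym : ∀ {D a b} → Marks D a b → Marks D b a
  marks-sym μ = record { on₁ = on₂ μ ; on₂ = on₁ μ ; off = λ p q → off μ q p }

  marks-≈ : ∀ {D a b b′} → b ≈ b′ [mod N ] → Marks D a b → Marks D a b′
  marks-≈ b≈b′ μ = record
    { on₁ = on₁ μ
    ; on₂ = λ w∼ → on₂ μ (≈-trans w∼ (≈-sym b≈b′))
    ; off = λ p q → off μ p (λ w∼ → q (≈-trans w∼ b≈b′))
    }

  pair-marks : ∀ (u₁ u₂ : Fin N) → Marks (pair u₁ u₂) (toℕ u₁) (toℕ u₂)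
  pair-marks u₁ u₂ = record
    { on₁ = λ {w} w∼ → Equivalence.to T-≡ (Equivalence.from (T-∨ {toℕ w ≡ᵇ toℕ u₁})
        (inj₁ (≡⇒≡ᵇ _ _ (≈⇒≡ (toℕ<n w) (toℕ<n u₁) w∼))))
    ; on₂ = λ {w} w∼ → Equivalence.to T-≡ (Equivalence.from (T-∨ {toℕ w ≡ᵇ toℕ u₁})
        (inj₂ (≡⇒≡ᵇ _ _ (≈⇒≡ (toℕ<n w) (toℕ<n u₂) w∼))))
    ; off = λ {w} p q → ¬T⇒false λ m → off-by p q (Equivalence.to (T-∨ {toℕ w ≡ᵇ toℕ u₁}) m)
    }
    where
    off-by : ∀ {w : Fin N} → ¬ w ∼ toℕ u₁ → ¬ w ∼ toℕ u₂ → ¬ (T (toℕ w ≡ᵇ toℕ u₁) ⊎ T (toℕ w ≡ᵇ toℕ u₂))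
    off-by p q (inj₁ e) = p (≈-reflexive (≡ᵇ⇒≡ _ _ e))
    off-by p q (inj₂ e) = q (≈-reflexive (≡ᵇ⇒≡ _ _ e))

  module _ {D : VSet N} where

    off-other : ∀ {e e′ s} → e < 2 → e′ < 2 → e ≢ e′ → ∀ i → ¬ vertex (i * 2 + e) ∼ (s * 2 + e′)
    off-other {e} {e′} {s} e<2 e′<2 e≢e′ i w∼ =
      classes-disjoint {e} {e′} {i} {s} e<2 e′<2 e≢e′ (≈-trans (≈-sym (vertex-∼ (i * 2 + e))) w∼)

    off-same : ∀ e {s i} → ¬ i ≈ s [mod M ] → ¬ vertex (i * 2 + e) ∼ (s * 2 + e)
    off-same e {s} {i} i≉s w∼ = i≉s (class-index e {i} {s} (≈-trans (≈-sym (vertex-∼ (i * 2 + e))) w∼))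

    shows-pair : ∀ e t x y → suc x + suc y ≡ M → Marks D (t * 2 + e) ((t + suc x) * 2 + e) →
      Shows (class D e) (runs (x ∷ y ∷ []))
    shows-pair e t x y x+y μ = two-marks t x y x+y (class-periodic D e)
      (on₁ μ (vertex-∼ (t * 2 + e))) (on₂ μ (vertex-∼ ((t + suc x) * 2 + e)))
      (λ j p q → off μ (off-same e p) (off-same e q))

    shows-empty : ∀ {e e′ s t} → e < 2 → e′ < 2 → e ≢ e′ → Marks D (s * 2 + e′) (t * 2 + e′) →
      Shows (class D e) full
    shows-empty {s = s} {t} e<2 e′<2 e≢e′ μ i =
      off μ (off-other {s = s} e<2 e′<2 e≢e′ i) (off-other {s = t} e<2 e′<2 e≢e′ i)

    shows-single : ∀ {e e′ s t} → e < 2 → e′ < 2 → e ≢ e′ → Marks D (s * 2 + e) (t * 2 + e′) →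
      Shows (class D e) (runs (3 + k * 3 ∷ []))
    shows-single {e} {s = s} {t} e<2 e′<2 e≢e′ μ = one-mark s (class-periodic D e)
      (on₁ μ (vertex-∼ (s * 2 + e))) (λ j p → off μ (off-same e p) (off-other {s = t} e<2 e′<2 e≢e′ j))

    same-class : ∀ {e} t x y → e < 2 → suc x + suc y ≡ M → Marks D (t * 2 + e) ((t + suc x) * 2 + e) →
      γgt∣ G D ≡ val Dominator 1 (runWeight x + runWeight y)
    same-class {0} t x y _ x+y μ = trans
      (γgt∣≡positionValue D (runs (x ∷ y ∷ []) , full)
        (shows-pair 0 t x y x+y μ , shows-empty {s = t} {t + suc x} ≤-refl (s≤s z≤n) (λ ()) μ))
      (cong (val Dominator 1) (trans (+-identityʳ _) (cong (runWeight x +_) (+-identityʳ _))))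
    same-class {1} t x y _ x+y μ = trans
      (γgt∣≡positionValue D (full , runs (x ∷ y ∷ []))
        (shows-empty {s = t} {t + suc x} (s≤s z≤n) ≤-refl (λ ()) μ , shows-pair 1 t x y x+y μ))
      (cong (val Dominator 1) (cong (runWeight x +_) (+-identityʳ _)))
    same-class {suc (suc _)} _ _ _ (s≤s (s≤s ()))

    -- Each class keeps one run of length 3(k + 1) and weight 4(k + 1), so W = 8(k + 1) and the
    -- value is W/2.
    different-classes : ∀ s t → Marks D (s * 2 + 0) (t * 2 + 1) → γgt∣ G D ≡ 4 + k * 4
    different-classes s t μ = trans
      (γgt∣≡positionValue D (runs (3 + k * 3 ∷ []) , runs (3 + k * 3 ∷ []))
        (shows-single {s = s} {t} (s≤s z≤n) ≤-refl (λ ()) μ ,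
         shows-single {s = t} {s} ≤-refl (s≤s z≤n) (λ ()) (marks-sym μ)))
      (trans (cong ⌊_/2⌋ weights) (trans (⌊k*4+n/2⌋ (2 + k * 2) 0) (lem k)))
      where
      weights : runsWeight (3 + k * 3 ∷ []) + runsWeight (3 + k * 3 ∷ []) ≡ (2 + k * 2) * 4 + 0
      weights rewrite runWeight-residue 0 k = lem′ k
        where
        lem′ : ∀ k → 4 + (k * 4) + 0 + (4 + (k * 4) + 0) ≡ (2 + k * 2) * 4 + 0
        lem′ = solve-∀
      lem : ∀ k → (2 + k * 2) * 2 + 0 ≡ 4 + k * 4
      lem = solve-∀

    split-marks : ∀ a d → Marks D a (a + d) → Marks D (a / 2 * 2 + a % 2) (a / 2 * 2 + a % 2 + d)
    split-marks a d = subst (λ z → Marks D z (z + d)) (trans (m≡m%n+[m/n]*n a 2) (+-comm (a % 2) _))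

    even-distance : ∀ a x y → suc x + suc y ≡ M → Marks D a (a + suc x * 2) →
      γgt∣ G D ≡ val Dominator 1 (runWeight x + runWeight y)
    even-distance a x y x+y μ = same-class (a / 2) x y (m%n<n a 2) x+y
      (subst (Marks D _) (lem (a / 2) (a % 2) (suc x)) (split-marks a (suc x * 2) μ))
      where
      lem : ∀ t e x → t * 2 + e + x * 2 ≡ (t + x) * 2 + e
      lem = solve-∀

    odd-distance : ∀ a c → Marks D a (a + (1 + c * 2)) → γgt∣ G D ≡ 4 + k * 4
    odd-distance a c μ = by-parity (a % 2) (m%n<n a 2) (split-marks a (1 + c * 2) μ)
      where
      by-parity : ∀ e → e < 2 → Marks D (a / 2 * 2 + e) (a / 2 * 2 + e + (1 + c * 2)) → γgt∣ G D ≡ 4 + k * 4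
      by-parity 0 _ μ = different-classes (a / 2) (a / 2 + c) (subst (Marks D _) (lem (a / 2) c) μ)
        where
        lem : ∀ t c → t * 2 + 0 + (1 + c * 2) ≡ (t + c) * 2 + 1
        lem = solve-∀
      -- From an odd start the second mark falls into the even class, so the marks change places.
      by-parity 1 _ μ = different-classes (a / 2 + suc c) (a / 2)
        (marks-sym (subst (Marks D _) (lem (a / 2) c) μ))
        where
        lem : ∀ t c → t * 2 + 1 + (1 + c * 2) ≡ (t + suc c) * 2 + 0
        lem = solve-∀
      by-parity (suc (suc _)) (s≤s (s≤s ()))

    -- The two gaps have total length 3k + 2, so residue `r` of one forces residue `2 ∸ r` of the
    -- other, and their quotients add up to `k`. The residues contribute 3, 4, 3 for `r` = 0, 1, 2.
    pair-weight : ∀ r q y → r < 3 → suc (r + q * 3) + suc y ≡ M →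
      runWeight (r + q * 3) + runWeight y ≡ k * 4 + (runWeight r + runWeight (2 ∸ r))
    pair-weight r q y r<3 x+y = begin
      runWeight (r + q * 3) + runWeight y
        ≡⟨ cong (λ z → runWeight (r + q * 3) + runWeight z) y≡ ⟩
      runWeight (r + q * 3) + runWeight (2 ∸ r + p * 3)
        ≡⟨ cong₂ _+_ (runWeight-residue r q) (runWeight-residue (2 ∸ r) p) ⟩
      runWeight r + q * 4 + (runWeight (2 ∸ r) + p * 4)
        ≡⟨ lem (runWeight r) (runWeight (2 ∸ r)) q p ⟩
      (q + p) * 4 + (runWeight r + runWeight (2 ∸ r))
        ≡⟨ cong (λ z → z * 4 + (runWeight r + runWeight (2 ∸ r))) q+p≡k ⟩
      k * 4 + (runWeight r + runWeight (2 ∸ r)) ∎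
      where
      open ≡-Reasoning
      p = k ∸ q
      lem : ∀ a b q p → a + q * 4 + (b + p * 4) ≡ (q + p) * 4 + (a + b)
      lem = solve-∀
      r≤2 : r ≤ 2
      r≤2 = ≤-pred r<3
      x+y≡ : r + q * 3 + y ≡ 2 + k * 3
      x+y≡ = suc-injective (suc-injective (trans (cong suc (sym (+-suc _ y))) x+y))
      q≤k : q ≤ k
      -- From 3q ≤ 3k + 2 < 3(k + 1).
      q≤k = ≤-pred (*-cancelʳ-< 3 q (suc k) (
        (s≤s (≤-trans (m≤n+m (q * 3) r) (≤-trans (m≤m+n _ y) (≤-reflexive x+y≡))))))
      q+p≡k : q + p ≡ k
      q+p≡k = m+[n∸m]≡n q≤k
      y≡ : y ≡ 2 ∸ r + p * 3
      y≡ = +-cancelˡ-≡ (r + q * 3) _ _ (trans x+y≡ (sym (begin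
        r + q * 3 + (2 ∸ r + p * 3)   ≡⟨ lem′ r (2 ∸ r) q p ⟩
        (r + (2 ∸ r)) + (q + p) * 3   ≡⟨ cong₂ (λ u v → u + v * 3) (m+[n∸m]≡n r≤2) q+p≡k ⟩
        2 + k * 3                     ∎)))
        where
        lem′ : ∀ r s q p → r + q * 3 + (s + p * 3) ≡ (r + s) + (q + p) * 3
        lem′ = solve-∀

    ThreeCases : ℕ → Set
    ThreeCases d = (d % 6 ≡ 4 → γgt∣ G D ≡ 5 + k * 4) ×
      (d % 6 ≡ 1 ⊎ d % 6 ≡ 3 ⊎ d % 6 ≡ 5 → γgt∣ G D ≡ 4 + k * 4) ×
      (d % 6 ≡ 0 ⊎ d % 6 ≡ 2 → γgt∣ G D ≡ 3 + k * 4)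

    three-cases : ∀ a d → 0 < d → d < N → Marks D a (a + d) → ThreeCases d
    three-cases a d 0<d d<N μ = four , odd , even
      where
      q = d / 6
      d≡ : ∀ {r} → d % 6 ≡ r → d ≡ r + q * 6
      d≡ e = trans (m≡m%n+[m/n]*n d 6) (cong (_+ q * 6) e)
      value-4 : val Dominator 1 (k * 4 + 4) ≡ 5 + k * 4
      value-4 rewrite ⌊k*4+n/2⌋ k 4 | ⌊k*2+n/2⌋ k 2 = lem k
        where
        lem : ∀ k → 3 + (k * 2 + (k + 1 + (k + 1))) ≡ 5 + k * 4
        lem = solve-∀
      -- Marks of one class at distance d = 2(x + 1) enclose a gap of length x = r + 3p; remainders
      -- 2, 4, 0 of d modulo 6 correspond to `r` = 0, 1, 2.
      at-even : ∀ r p → r < 3 → d ≡ suc (r + p * 3) * 2 →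
        γgt∣ G D ≡ val Dominator 1 (k * 4 + (runWeight r + runWeight (2 ∸ r)))
      at-even r p r<3 e = trans (even-distance a x y x+y (subst (λ z → Marks D a (a + z)) e μ))
        (cong (val Dominator 1) (pair-weight r p y r<3 x+y))
        where
        x = r + p * 3
        sx<M : suc x < M
        sx<M = *-cancelʳ-< 2 (suc x) M (subst (_< N) e d<N)
        y = M ∸ suc (suc x)
        x+y : suc x + suc y ≡ M
        x+y = trans (+-suc (suc x) y) (m+[n∸m]≡n sx<M)
      four : d % 6 ≡ 4 → γgt∣ G D ≡ 5 + k * 4
      four e = trans (at-even 1 q (s≤s (s≤s z≤n)) (trans (d≡ e) (lem q))) value-4
        where
        lem : ∀ q → 4 + q * 6 ≡ suc (1 + q * 3) * 2
        lem = solve-∀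
      at-odd : ∀ r → d % 6 ≡ 1 + r * 2 → γgt∣ G D ≡ 4 + k * 4
      at-odd r e = odd-distance a (r + q * 3)
        (subst (λ z → Marks D a (a + z)) (trans (d≡ e) (lem r q)) μ)
        where
        lem : ∀ r q → 1 + r * 2 + q * 6 ≡ 1 + (r + q * 3) * 2
        lem = solve-∀
      odd : d % 6 ≡ 1 ⊎ d % 6 ≡ 3 ⊎ d % 6 ≡ 5 → γgt∣ G D ≡ 4 + k * 4
      odd (inj₁ e)        = at-odd 0 e
      odd (inj₂ (inj₁ e)) = at-odd 1 e
      odd (inj₂ (inj₂ e)) = at-odd 2 e
      -- The distance 6(q + 1) has gap length 3q + 2, which lowers the quotient by one; d = 0 is
      -- excluded. Here and for remainder 2, `dominator-opens₂` serves as the value at weight 4k +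
      -- 3.
      at-multiple : ∀ q → d ≡ q * 6 → γgt∣ G D ≡ 3 + k * 4
      at-multiple zero    e = contradiction (sym e) (<⇒≢ 0<d)
      at-multiple (suc q) e = trans (at-even 2 q ≤-refl (trans e (lem q))) dominator-opens₂
        where
        lem : ∀ q → 6 + q * 6 ≡ suc (2 + q * 3) * 2
        lem = solve-∀
      even : d % 6 ≡ 0 ⊎ d % 6 ≡ 2 → γgt∣ G D ≡ 3 + k * 4
      even (inj₁ e) = at-multiple q (d≡ e)
      even (inj₂ e) = trans (at-even 0 q (s≤s z≤n) (trans (d≡ e) (lem q))) dominator-opens₂
        where
        lem : ∀ q → 2 + q * 6 ≡ suc (0 + q * 3) * 2
        lem = solve-∀

    -- Either arc between the marks may be the shorter one.
    ordered : ∀ i j → i < j → j < N → Marks D i j → ThreeCases ((j ∸ i) ⊓ (N ∸ (j ∸ i)))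
    ordered i j i<j j<N μ = [ inner , outer ]′ (⊓-sel (j ∸ i) (N ∸ (j ∸ i)))
      where
      δ<N : j ∸ i < N
      δ<N = ≤-<-trans (m∸n≤m j i) j<N
      wrap : i + 1 * N ≡ j + (N ∸ (j ∸ i))
      wrap = begin
        i + 1 * N                            ≡⟨ cong (i +_) (*-identityˡ N) ⟩
        i + N                                ≡⟨ cong (i +_) (m+[n∸m]≡n (<⇒≤ δ<N)) ⟨
        i + ((j ∸ i) + (N ∸ (j ∸ i)))        ≡⟨ +-assoc i (j ∸ i) _ ⟨
        i + (j ∸ i) + (N ∸ (j ∸ i))          ≡⟨ cong (_+ (N ∸ (j ∸ i))) (m+[n∸m]≡n (<⇒≤ i<j)) ⟩
        j + (N ∸ (j ∸ i))                    ∎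
        where open ≡-Reasoning
      inner : ∀ {d} → d ≡ j ∸ i → ThreeCases d
      inner e = subst ThreeCases (sym e)
        (three-cases i (j ∸ i) (m<n⇒0<n∸m i<j) δ<N (subst (Marks D i) (sym (m+[n∸m]≡n (<⇒≤ i<j))) μ))
      outer : ∀ {d} → d ≡ N ∸ (j ∸ i) → ThreeCases d
      outer e = subst ThreeCases (sym e)
        (three-cases j (N ∸ (j ∸ i)) (m<n⇒0<n∸m δ<N) (∸-monoʳ-< (m<n⇒0<n∸m i<j) (<⇒≤ δ<N))
          (marks-≈ (≈-trans (≈-sym (≈-+* i 1)) (≈-reflexive wrap)) (marks-sym μ)))

  pair-cases : ∀ u₁ u₂ → u₁ ≢ u₂ → ThreeCases {pair u₁ u₂} (cycDist N u₁ u₂)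
  pair-cases u₁ u₂ u₁≢u₂ = by-order (<-cmp (toℕ u₁) (toℕ u₂))
    where
    Claim : ℕ → Set
    Claim δ = ThreeCases {pair u₁ u₂} (δ ⊓ (N ∸ δ))
    by-order : Tri (toℕ u₁ < toℕ u₂) (toℕ u₁ ≡ toℕ u₂) (toℕ u₁ > toℕ u₂) → Claim ∣ toℕ u₁ - toℕ u₂ ∣
    by-order (tri< i<j _ _) = subst Claim (sym (m≤n⇒∣m-n∣≡n∸m (<⇒≤ i<j)))
      (ordered (toℕ u₁) (toℕ u₂) i<j (toℕ<n u₂) (pair-marks u₁ u₂))
    by-order (tri≈ _ i≡j _) = contradiction (toℕ-injective i≡j) u₁≢u₂
    by-order (tri> _ _ j<i) = subst Claim
      (sym (trans (∣-∣-comm (toℕ u₁) (toℕ u₂)) (m≤n⇒∣m-n∣≡n∸m (<⇒≤ j<i))))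
      (ordered (toℕ u₂) (toℕ u₁) j<i (toℕ<n u₁) (marks-sym (pair-marks u₁ u₂)))

-- All orders congruent to 2 modulo 6

order-form : ∀ n → n % 6 ≡ 2 → 8 ≤ n → ∃[ k ] n ≡ (4 + k * 3) * 2
order-form n n%6≡2 8≤n = by-quotient (n / 6) (trans (m≡m%n+[m/n]*n n 6) (cong (_+ n / 6 * 6) n%6≡2))
  where
  by-quotient : ∀ q → n ≡ 2 + q * 6 → ∃[ k ] n ≡ (4 + k * 3) * 2
  by-quotient zero    e = contradiction (subst (8 ≤_) e 8≤n) λ { (s≤s (s≤s ())) }
  -- The quotient of `n` by 6 is `k` + 1, positive because 8 ≤ `n`; this is the shift in `k` used
  -- throughout.
  by-quotient (suc k) e = k , trans e (lem k)
    where
    lem : ∀ k → 8 + k * 6 ≡ (4 + k * 3) * 2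
    lem = solve-∀

-- Stated as a predicate of `n`, so that the result for `(4 + k * 3) * 2`, including the types of
-- the two vertices, can be transported along the equation for `n`.
PairTheorem : ℕ → Set
PairTheorem n = (u₁ u₂ : Fin n) → u₁ ≢ u₂ →
    ((cycDist n u₁ u₂ % 6 ≡ 4 →
    γgt∣ (Cycle n) (pair u₁ u₂) ≡ γgt (Cycle n))
    × ((cycDist n u₁ u₂ % 6 ≡ 1 ⊎ cycDist n u₁ u₂ % 6 ≡ 3 ⊎ cycDist n u₁ u₂ % 6 ≡ 5) →
    γgt∣ (Cycle n) (pair u₁ u₂) ≡ γgt (Cycle n) ∸ 1)
    × ((cycDist n u₁ u₂ % 6 ≡ 0 ⊎ cycDist n u₁ u₂ % 6 ≡ 2) →
    γgt∣ (Cycle n) (pair u₁ u₂) ≡ γgt (Cycle n) ∸ 2))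

pairTheorem : ∀ k → PairTheorem ((4 + k * 3) * 2)
pairTheorem k u₁ u₂ u₁≢u₂ =
  (λ e → trans (proj₁ cases e) (sym γgt≡)) ,
  (λ e → trans (proj₁ (proj₂ cases) e) (cong (_∸ 1) (sym γgt≡))) ,
  (λ e → trans (proj₂ (proj₂ cases) e) (cong (_∸ 2) (sym γgt≡)))
  where
  open Pairs k
  cases = pair-cases u₁ u₂ u₁≢u₂

theorem3p1 : (n : ℕ) → n % 6 ≡ 2 → 8 ≤ n → (u₁ u₂ : Fin n) → u₁ ≢ u₂ →
    ((cycDist n u₁ u₂ % 6 ≡ 4 →
    γgt∣ (Cycle n) (pair u₁ u₂) ≡ γgt (Cycle n))
    × ((cycDist n u₁ u₂ % 6 ≡ 1 ⊎ cycDist n u₁ u₂ % 6 ≡ 3 ⊎ cycDist n u₁ u₂ % 6 ≡ 5) →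
    γgt∣ (Cycle n) (pair u₁ u₂) ≡ γgt (Cycle n) ∸ 1)
    × ((cycDist n u₁ u₂ % 6 ≡ 0 ⊎ cycDist n u₁ u₂ % 6 ≡ 2) →
    γgt∣ (Cycle n) (pair u₁ u₂) ≡ γgt (Cycle n) ∸ 2))
theorem3p1 n n%6≡2 8≤n =
  subst PairTheorem (sym (proj₂ (order-form n n%6≡2 8≤n))) (pairTheorem (proj₁ (order-form n n%6≡2 8≤n)))
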